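{- For every integer $n\geq 1$, the middle layer graph $Q_{2n+1}(n,n+1)$ has a Hamilton cycle.
   Context: For $m\geq 1$ and $0\leq k\leq m$, let $B_m(k)$ denote the set of bitstrings of length $m$ with exactly $k$ entries equal to $1$. The middle layer graph $Q_{2n+1}(n,n+1)$ is the graph with vertex set $B_{2n+1}(n)\cup B_{2n+1}(n+1)$, in which two vertices are adjacent if and only if the corresponding bitstrings differ in exactly one bit. -}

module Defs where

open import Data.Nat using (ℕ; zero; suc; _+_; _*_)
open import Data.Bool using (Bool; true; false)
open import Data.Vec using (Vec; []; _∷_; count)
open import Data.List using (List; []; _∷_)
open import Data.List.Relation.Unary.All using (All)
open import Data.List.Relation.Unary.Unique.Propositional using (Unique)
open import Data.List.Membership.Propositional using (_∈_)
open import Data.Product using (_×_)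
open import Data.Sum using (_⊎_)
open import Relation.Binary.PropositionalEquality using (_≡_)
open import Relation.Nullary using (¬_)

Bitstring : ℕ → Set
Bitstring m = Vec Bool m

weight : ∀ {m} → Bitstring m → ℕ
weight {m} x = count (λ b → b Data.Bool.≟ true) x

InB : (m k : ℕ) → Bitstring m → Set
InB m k x = weight x ≡ k

hamming : ∀ {m} → Bitstring m → Bitstring m → ℕ
hamming [] [] = 0
hamming (true ∷ xs) (true ∷ ys) = hamming xs ys
hamming (false ∷ xs) (false ∷ ys) = hamming xs ys
hamming (true ∷ xs) (false ∷ ys) = suc (hamming xs ys)
hamming (false ∷ xs) (true ∷ ys) = suc (hamming xs ys)

MiddleVertex : (n : ℕ) → Bitstring (suc (2 * n)) → Set
MiddleVertex n x = InB (suc (2 * n)) n x ⊎ InB (suc (2 * n)) (suc n) x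

Adjacent : ∀ {m} → Bitstring m → Bitstring m → Set
Adjacent x y = hamming x y ≡ 1

data Path {A : Set} (R : A → A → Set) : List A → Set where
  path[]  : Path R []
  path[_] : ∀ x → Path R (x ∷ [])
  path∷   : ∀ {x y zs} → R x y → Path R (y ∷ zs) → Path R (x ∷ y ∷ zs)

lastOf : {A : Set} → A → List A → A
lastOf x [] = x
lastOf x (y ∷ ys) = lastOf y ys

-- A Hamilton cycle in Q_{2n+1}(n,n+1): a cyclic sequence of vertices
-- v₀, …, v_{L-1} (given as the list v₀ ∷ vs) such that every entry is a
-- vertex of the graph, no vertex repeats, every vertex of the graph occurs,
-- consecutive entries are adjacent, and v_{L-1} is adjacent to v₀.
-- (The graph has at least 6 vertices for n ≥ 1, so L ≥ 3 automatically.)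
record HamiltonCycle (n : ℕ) : Set where
  field
    start    : Bitstring (suc (2 * n))
    rest     : List (Bitstring (suc (2 * n)))
    vertices : All (MiddleVertex n) (start ∷ rest)
    distinct : Unique (start ∷ rest)
    spanning : ∀ x → MiddleVertex n x → x ∈ (start ∷ rest)
    edges    : Path Adjacent (start ∷ rest)
    closing  : Adjacent (lastOf start rest) start

{-# OPTIONS --safe #-}
module Submission where

-- A Dyck word w of length 2n with first factorisation w = 1 u 0 v has the rotation r(w) = u 1 v 0, which
-- moves the root of the corresponding tree to a neighbour.  By the cycle lemma the vertices of weight n
-- are exactly the cyclic shifts of the words w 0, and those of weight n + 1 the shifts of the words 1 w.
-- Flipping two bits in turn, 1 u 0 v 0, then 1 u 1 v 0 = 1 r(w), then 0 u 1 v 0 = 0 r(w), which is a shift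
-- of r(w) 0, gives a permutation F whose cycles partition the graph.
--
-- If x is a shift of 1 1 0 u 0 v 0 and y the same shift of 1 0 1 u 0 v 0 (a leaf of x pulled to its
-- grandparent), then x, F y, y, F⁵ x, F⁶ x, F x is a 6-cycle.  Taking the symmetric difference joins the
-- F-cycle of x to a cycle through the edge y, F y, by inserting a rearrangement of the former into that
-- edge; no edge z, F z at which a later gluing takes place is lost.  Every tree that is not a star admits,
-- after moving the root, a pull that decreases the sum of the depths, so starting from the F-cycle of the
-- star (which contains all its shifts) every vertex can be glued in.

open import Defs
open import Data.Bool using (Bool; false; if_then_else_; not; true)
open import Data.Bool.Properties using (not-involutive)
open import Data.Fin using (Fin; combine; fromℕ; inject₁; suc; toℕ; zero)
open import Data.Fin.Relation.Unary.Top using (view; ‵fromℕ; ‵inject₁)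
open import Data.List
  using (List; []; [_]; _++_; _∷_; _∷ʳ_; _∷ʳ′_; allFin; applyUpTo; cartesianProductWith; drop;
    initLast; length; map; reverse; take)
open import Data.List.Membership.Propositional using (_∈_; _∉_)
open import Data.List.Membership.Propositional.Properties
  using (∈-++⁺ʳ; ∈-++⁺ˡ; ∈-++⁻; ∈-allFin; ∈-applyUpTo⁺; ∈-applyUpTo⁻; ∈-cartesianProductWith⁺;
    ∈-map⁺)
open import Data.List.Properties
  using (++-assoc; ++-identityʳ; length-++; length-take; reverse-++; reverse-involutive;
    take++drop≡id; unfold-reverse; ∷-injectiveʳ; ∷ʳ-injective; ∷ʳ-injectiveˡ)
open import Data.List.Relation.Binary.Permutation.Propositional
  using (_↭_; prep; ↭-refl; ↭-reflexive; ↭-sym; ↭-trans; ↭⇒↭ₛ)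
open import Data.List.Relation.Binary.Permutation.Propositional.Properties
  using (++⁺ʳ; shift; ↭-reverse; ∈-resp-↭)
open import Data.List.Relation.Unary.All using (All)
open import Data.List.Relation.Unary.Any using (here; index; there)
open import Data.List.Relation.Unary.Unique.Propositional using (Unique)
open import Data.Maybe using (Maybe; just; nothing)
open import Data.Nat using (_*_; _+_; _<_; _≟_; _≤_; _≥_; suc; s≤s; s≤s⁻¹; zero; z≤n; ℕ)
open import Data.Nat.Properties
open import Data.Product using (_,_; _×_; proj₁; proj₂; ∃; ∃₂)
open import Data.Sum using (_⊎_; inj₁; inj₂)
open import Data.Vec using ([]; _∷_; toList)
open import Data.Vec.Properties using (length-toList)
open import Function using (_∘_; case_of_; id)
open import Relation.Binary.Construct.Closure.Equivalence
  using (EqClosure; gfold; reflexive; return; symmetric; transitive)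
open import Relation.Binary.Construct.Closure.ReflexiveTransitive using (_◅_; ε)
open import Relation.Binary.Construct.Closure.Symmetric using (bwd; fwd)
open import Relation.Binary.Definitions using (DecidableEquality)
open import Relation.Binary.PropositionalEquality hiding ([_])
open import Relation.Nullary using (Dec; contradiction; no; recompute; yes; ¬_)
import Data.List.Relation.Binary.Permutation.Setoid.Properties as Permutationₛ
import Data.List.Relation.Unary.Unique.Propositional.Properties as Unique
import Data.List.Membership.DecPropositional as DecMembership
import Data.Fin.Properties as Fin
import Data.List.Membership.Setoid.Properties as Membershipₛ
import Data.List.Relation.Unary.All as All
import Data.List.Relation.Unary.All.Properties as All

-- Consecutive entries of a list and insertion between them.

module _ {A : Set} where

  -- The tail in `there` is displayed as a cons, so that a link recurses in step with `path∷` and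
  -- with the fixed head of `insert`.
  data Link (u v : A) : List A → Set where
    here  : ∀ {xs} → Link u v (u ∷ v ∷ xs)
    there : ∀ {x y xs} → Link u v (y ∷ xs) → Link u v (x ∷ y ∷ xs)

  Edge : A → A → List A → Set
  Edge u v xs = Link u v xs ⊎ Link v u xs

  link-++ˡ : ∀ {u v xs} ys → Link u v xs → Link u v (xs ++ ys)
  link-++ˡ ys here      = here
  link-++ˡ ys (there l) = there (link-++ˡ ys l)

  link-∷ : ∀ {u v x xs} → Link u v xs → Link u v (x ∷ xs)
  link-∷ here      = there here
  link-∷ (there l) = there (there l)

  link-++ʳ : ∀ {u v ys} xs → Link u v ys → Link u v (xs ++ ys)
  link-++ʳ []       l = l
  link-++ʳ (x ∷ xs) l = link-∷ (link-++ʳ xs l)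

  link-reverse : ∀ {u v xs} → Link u v xs → Link v u (reverse xs)
  link-reverse {u} {v} (here {xs}) =
    subst (Link v u) (sym (reverse-++ (u ∷ v ∷ []) xs)) (link-++ʳ (reverse xs) here)
  link-reverse {u} {v} (there {x} {y} {xs} l) =
    subst (Link v u) (sym (unfold-reverse x (y ∷ xs))) (link-++ˡ _ (link-reverse l))

  link-applyUpTo : ∀ f n {i} → suc i < n → Link (f i) (f (suc i)) (applyUpTo f n)
  link-applyUpTo f (suc (suc n)) {zero}  _       = here
  link-applyUpTo f (suc zero)    {zero}  (s≤s ())
  link-applyUpTo f (suc (suc n)) {suc i} (s≤s p) = there (link-applyUpTo (f ∘ suc) (suc n) p)

  edge-++ʳ : ∀ {u v ys} xs → Edge u v ys → Edge u v (xs ++ ys)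
  edge-++ʳ xs (inj₁ l) = inj₁ (link-++ʳ xs l)
  edge-++ʳ xs (inj₂ l) = inj₂ (link-++ʳ xs l)

  edge-reverse : ∀ {u v xs} → Edge u v xs → Edge u v (reverse xs)
  edge-reverse (inj₁ l) = inj₂ (link-reverse l)
  edge-reverse (inj₂ l) = inj₁ (link-reverse l)

  module _ {R : A → A → Set} where

    path⇒link : ∀ {u v xs} → Path R xs → Link u v xs → R u v
    path⇒link (path∷ r p) here      = r
    path⇒link (path∷ r p) (there l) = path⇒link p l

    link⇒path : ∀ xs → (∀ {u v} → Link u v xs → R u v) → Path R xs
    link⇒path []           f = path[]
    link⇒path (x ∷ [])     f = path[ x ]
    link⇒path (x ∷ y ∷ xs) f = path∷ (f here) (link⇒path (y ∷ xs) (f ∘ there))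

    path-reverse : (∀ {u v} → R u v → R v u) → ∀ {xs} → Path R xs → Path R (reverse xs)
    path-reverse R-sym {xs} p = link⇒path (reverse xs) λ {u} {v} l →
      R-sym (path⇒link p (subst (Link v u) (reverse-involutive xs) (link-reverse l)))

    path-++ : ∀ xs {y ys} → Path R (xs ++ [ y ]) → Path R (y ∷ ys) → Path R (xs ++ y ∷ ys)
    path-++ []            p           q = q
    path-++ (x ∷ [])      (path∷ r p) q = path∷ r q
    path-++ (x ∷ x′ ∷ xs) (path∷ r p) q = path∷ r (path-++ (x′ ∷ xs) p q)

  -- insert l zs is the new tail: the first element x stays in place.
  insert : ∀ {u v x xs} → Link u v (x ∷ xs) → List A → List A
  insert {v = v} (here {xs})  zs = zs ++ v ∷ xs
  insert (there {y = y} l) zs = y ∷ insert l zs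

  module _ {u v : A} (zs : List A) where

    insert-↭ : ∀ {x xs} (l : Link u v (x ∷ xs)) → x ∷ insert l zs ↭ zs ++ x ∷ xs
    insert-↭ (here {xs})            = ↭-sym (shift u zs (v ∷ xs))
    insert-↭ (there {x} {y} {xs} l) =
      ↭-trans (prep x (insert-↭ l)) (↭-sym (shift x zs (y ∷ xs)))

    insert-lastOf : ∀ {x xs} (l : Link u v (x ∷ xs)) → lastOf x (insert l zs) ≡ lastOf x xs
    insert-lastOf here      = lastOf-++ u zs v _
      where
      lastOf-++ : ∀ x ys y xs → lastOf x (ys ++ y ∷ xs) ≡ lastOf y xs
      lastOf-++ x []       y xs = refl
      lastOf-++ x (z ∷ ys) y xs = lastOf-++ z ys y xs
    insert-lastOf (there l) = insert-lastOf l

    insert-path : ∀ {R : A → A → Set} {x xs} (l : Link u v (x ∷ xs)) →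
                  Path R (u ∷ zs ++ [ v ]) → Path R (x ∷ xs) → Path R (x ∷ insert l zs)
    insert-path here      p (path∷ _ q)               = path-++ (u ∷ zs) p q
    insert-path (there here)        p (path∷ r q) = path∷ r (insert-path here p q)
    insert-path (there l@(there _)) p (path∷ r q) = path∷ r (insert-path l p q)

    -- Only the adjacency at `l` is torn apart; all other old links move along intact.
    insert-linkᵒ : ∀ {a b x xs} (l : Link u v (x ∷ xs)) → Link a b (x ∷ xs) →
                   Link a b (x ∷ insert l zs) ⊎ (a ≡ u × b ≡ v)
    insert-linkᵒ here      here      = inj₂ (refl , refl)
    insert-linkᵒ here      (there k) = inj₁ (link-++ʳ (u ∷ zs) k)
    insert-linkᵒ (there l) here      = inj₁ here
    insert-linkᵒ (there l) (there k) with insert-linkᵒ l k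
    ... | inj₁ k′ = inj₁ (link-∷ k′)
    ... | inj₂ e  = inj₂ e

    insert-linkⁿ : ∀ {a b x xs} (l : Link u v (x ∷ xs)) → Link a b zs →
                   Link a b (x ∷ insert l zs)
    insert-linkⁿ here      k = link-∷ (link-++ˡ (v ∷ _) k)
    insert-linkⁿ (there l) k = link-∷ (insert-linkⁿ l k)

  unique-resp-↭ : {xs ys : List A} → xs ↭ ys → Unique xs → Unique ys
  unique-resp-↭ p = Permutationₛ.Unique-resp-↭ (setoid A) (↭⇒↭ₛ p)

least : ∀ {P : ℕ → Set} → (∀ i → Dec (P i)) → ∀ {k} → P k →
        ∃ λ m → P m × (∀ i → i < m → ¬ P i)
least {P} P? {k} Pk = case search k of λ where
    (inj₁ found) → found
    (inj₂ none)  → k , Pk , none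
  where
  search : ∀ m → (∃ λ j → P j × (∀ i → i < j → ¬ P i)) ⊎ (∀ i → i < m → ¬ P i)
  search zero    = inj₂ λ _ ()
  search (suc m) with search m
  ... | inj₁ found = inj₁ found
  ... | inj₂ none with P? m
  ...   | yes Pm = inj₁ (m , Pm , none)
  ...   | no ¬Pm = inj₂ λ i i<1+m → case m≤n⇒m<n∨m≡n (s≤s⁻¹ i<1+m) of λ where
            (inj₁ i<m)  → none i i<m
            (inj₂ refl) → ¬Pm

-- Trees, changes of root and pulls.

-- Ordered rooted trees as Dyck words: nil is the empty word and node u v is 1 u 0 v.
data Tree : Set where
  nil  : Tree
  node : Tree → Tree → Tree

size : Tree → ℕ
size nil        = 0
size (node u v) = suc (size u + size v)

infixr 5 _⊕_
-- Merging two trees at their roots, which concatenates the Dyck words.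
_⊕_ : Tree → Tree → Tree
nil      ⊕ c = c
node a b ⊕ c = node a (b ⊕ c)

⊕-assoc : ∀ a b c → (a ⊕ b) ⊕ c ≡ a ⊕ (b ⊕ c)
⊕-assoc nil        b c = refl
⊕-assoc (node u v) b c = cong (node u) (⊕-assoc v b c)

⊕-identityʳ : ∀ a → a ⊕ nil ≡ a
⊕-identityʳ nil        = refl
⊕-identityʳ (node u v) = cong (node u) (⊕-identityʳ v)

size-⊕ : ∀ a b → size (a ⊕ b) ≡ size a + size b
size-⊕ nil        b = refl
size-⊕ (node u v) b = cong suc (trans (cong (size u +_) (size-⊕ v b)) (sym (+-assoc (size u) _ _)))

infixl 6 _▹_
-- The Dyck word u 1 v 0, which splits off the last subtree where `node` splits off the first.
_▹_ : Tree → Tree → Tree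
u ▹ v = u ⊕ node v nil

size-▹ : ∀ u v → size (u ▹ v) ≡ suc (size u + size v)
size-▹ u v = trans (size-⊕ u (node v nil))
  (trans (cong (λ k → size u + suc k) (+-identityʳ (size v))) (+-suc (size u) (size v)))

rotate : Tree → Tree
rotate nil        = nil
rotate (node u v) = u ▹ v

size-rotate : ∀ t → size (rotate t) ≡ size t
size-rotate nil        = refl
size-rotate (node u v) = size-▹ u v

node-injective : ∀ {a b c d} → node a b ≡ node c d → a ≡ c × b ≡ d
node-injective refl = refl , refl

▹≢nil : ∀ u {v} → u ▹ v ≢ nil
▹≢nil nil        ()
▹≢nil (node _ _) ()

▹-injective : ∀ u u′ {v v′} → u ▹ v ≡ u′ ▹ v′ → u ≡ u′ × v ≡ v′
▹-injective nil        nil          refl = refl , refl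
▹-injective nil        (node a b)   eq = contradiction (sym (proj₂ (node-injective eq))) (▹≢nil b)
▹-injective (node a b) nil          eq = contradiction (proj₂ (node-injective eq)) (▹≢nil b)
▹-injective (node a b) (node a′ b′) eq with node-injective eq
... | refl , eq′ with ▹-injective b b′ eq′
...   | refl , refl = refl , refl

rotate-injective : ∀ t t′ → rotate t ≡ rotate t′ → t ≡ t′
rotate-injective nil        nil          _  = refl
rotate-injective nil        (node u v)   eq = contradiction (sym eq) (▹≢nil u)
rotate-injective (node u v) nil          eq = contradiction eq (▹≢nil u)
rotate-injective (node u v) (node u′ v′) eq with ▹-injective u u′ eq
... | refl , refl = refl

unsnoc : ∀ a b → ∃₂ λ u v → node a b ≡ u ▹ v
unsnoc a nil        = nil , a , refl
unsnoc a (node b c) with unsnoc b c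
... | u , v , eq = node a u , v , cong (node a) eq

rotate-surjective : ∀ t → ∃ λ t′ → rotate t′ ≡ t
rotate-surjective nil        = nil , refl
rotate-surjective (node a b) with unsnoc a b
... | u , v , eq = node u v , sym eq

infix 4 _~_
-- Its classes are the plane trees, in which neither a root nor a first edge at the root is
-- distinguished.
_~_ : Tree → Tree → Set
_~_ = EqClosure (λ t t′ → rotate t ≡ t′)

infixr 5 _⊙_
_⊙_ : ∀ {a b c} → a ~ b → b ~ c → a ~ c
_⊙_ = transitive _

~-rotate : ∀ t → t ~ rotate t
~-rotate t = return refl

~-≡ : ∀ {t t′} → t ≡ t′ → t ~ t′
~-≡ refl = reflexive _

-- Moving the root along its last edge.
~-reroot : ∀ a b → a ▹ b ~ b ▹ a
-- The root stays and another edge becomes the first: a rotation followed by `~-reroot` carries the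
-- first subtree `a₁` behind `c`, and induction carries the rest. Both mutual inductions run on the
-- first argument, while the second one grows.
~-⊕-comm : ∀ a c → a ⊕ c ~ c ⊕ a

~-reroot nil          b = ~-rotate (node b nil)
~-reroot (node a₁ a₂) b =
  ~-rotate (node a₁ (a₂ ▹ b)) ⊙ ~-reroot a₁ (a₂ ▹ b) ⊙
  ~-≡ (⊕-assoc a₂ (node b nil) (node a₁ nil)) ⊙
  ~-⊕-comm a₂ (node b (node a₁ nil)) ⊙ ~-rotate (node b (node a₁ a₂))

~-⊕-comm nil          c = ~-≡ (sym (⊕-identityʳ c))
~-⊕-comm (node a₁ a₂) c =
  ~-rotate (node a₁ (a₂ ⊕ c)) ⊙ ~-reroot a₁ (a₂ ⊕ c) ⊙
  ~-≡ (⊕-assoc a₂ c (node a₁ nil)) ⊙ ~-⊕-comm a₂ (c ▹ a₁) ⊙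
  ~-≡ (⊕-assoc c (node a₁ nil) a₂)

-- Each vertex other than the root counts with its depth minus one; for a fixed size this differs
-- from the sum of the depths by a constant.
depthSum : Tree → ℕ
depthSum nil        = 0
depthSum (node u v) = (depthSum u + size u) + depthSum v

data Pull : Tree → Tree → Set where
  pull  : ∀ {u v} → Pull (node (node nil u) v) (node nil (node u v))
  left  : ∀ {a a′ b} → Pull a a′ → Pull (node a b) (node a′ b)
  right : ∀ {a b b′} → Pull b b′ → Pull (node a b) (node a b′)

pull-size : ∀ {t t′} → Pull t t′ → size t′ ≡ size t
pull-size (pull {u} {v})     = refl
pull-size (left {b = b} p)   = cong (λ k → suc (k + size b)) (pull-size p)
pull-size (right {a = a} p)  = cong (λ k → suc (size a + k)) (pull-size p)

-- The pulled leaf rises by one level and every other vertex keeps its depth.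
pull-depthSum : ∀ {t t′} → Pull t t′ → depthSum t′ < depthSum t
pull-depthSum (pull {u} {v})    =
  +-monoˡ-< (depthSum v) (+-monoʳ-< (depthSum u) (n<1+n (size u)))
pull-depthSum (left {a} {a′} {b} p) rewrite pull-size p =
  +-monoˡ-< (depthSum b) (+-monoˡ-< (size a) (pull-depthSum p))
pull-depthSum (right {a = a} p) = +-monoʳ-< (depthSum a + size a) (pull-depthSum p)

star : ℕ → Tree
star zero    = nil
star (suc n) = node nil (star n)

size-star : ∀ n → size (star n) ≡ n
size-star zero    = refl
size-star (suc n) = cong suc (size-star n)

star-▹ : ∀ n → star n ▹ nil ≡ star (suc n)
star-▹ zero    = refl
star-▹ (suc n) = cong (node nil) (star-▹ n)

-- Among the deepest leaves there is a leftmost child, which can be pulled to its grandparent.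
star⊎pull : ∀ t → t ≡ star (size t) ⊎ ∃ (Pull t)
star⊎pull nil        = inj₁ refl
star⊎pull (node a b) with star⊎pull a
... | inj₂ (a′ , p) = inj₂ (node a′ b , left p)
star⊎pull (node (node nil a₂) b) | inj₁ _ = inj₂ (_ , pull)
star⊎pull (node (node (node _ _) _) b) | inj₁ ()
star⊎pull (node nil b) | inj₁ _ with star⊎pull b
... | inj₁ eq       = inj₁ (cong (node nil) eq)
... | inj₂ (b′ , p) = inj₂ (node nil b′ , right p)

-- The 6-cycles realise a pull only at the root, but the tours constructed below contain a tree
-- together with its whole `~`-class, so it is enough to bring the pull to the root.
GluingPair : Tree → Tree → Set
GluingPair t t′ = ∃₂ λ u v → t ~ node (node nil u) v × node nil (node u v) ~ t′

~-gluingPair : ∀ {a b c d} → a ~ b → GluingPair b c → c ~ d → GluingPair a d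
~-gluingPair p (u , v , q , r) s = u , v , p ⊙ q , r ⊙ s

-- c collects the part of the tree outside the subtree in which the pull takes place.
pull-gluingPair-⊕ : ∀ {t t′} → Pull t t′ → ∀ c → GluingPair (t ⊕ c) (t′ ⊕ c)
pull-gluingPair-⊕ (pull {u} {v}) c = u , v ⊕ c , reflexive _ , reflexive _
-- After one rotation the root of `a` is the root of the whole tree, and `b ⊕ c` hangs there as one
-- more subtree.
pull-gluingPair-⊕ (left {a} {a′} {b} p) c =
  ~-gluingPair (~-rotate (node a (b ⊕ c)))
    (pull-gluingPair-⊕ p (node (b ⊕ c) nil))
    (symmetric _ (~-rotate (node a′ (b ⊕ c))))
pull-gluingPair-⊕ (right {a} {b} {b′} p) c =
  ~-gluingPair (move b)
    (pull-gluingPair-⊕ p (c ▹ a))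
    (symmetric _ (move b′))
  where
  -- The first subtree `a` is carried round to the end, where it joins `c`.
  move : ∀ d → node a (d ⊕ c) ~ d ⊕ (c ▹ a)
  move d = ~-⊕-comm (node a nil) (d ⊕ c) ⊙ ~-≡ (⊕-assoc d c (node a nil))

pull-gluingPair : ∀ {t t′} → Pull t t′ → GluingPair t t′
pull-gluingPair {t} {t′} p = subst₂ GluingPair (⊕-identityʳ t) (⊕-identityʳ t′) (pull-gluingPair-⊕ p nil)

infix 4 _≟ᵗ_
_≟ᵗ_ : (t t′ : Tree) → Dec (t ≡ t′)
nil      ≟ᵗ nil      = yes refl
nil      ≟ᵗ node _ _ = no λ ()
node _ _ ≟ᵗ nil      = no λ ()
node a b ≟ᵗ node c d with a ≟ᵗ c | b ≟ᵗ d
... | yes refl | yes refl = yes refl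
... | no a≢c   | _        = no λ { refl → a≢c refl }
... | yes _    | no b≢d   = no λ { refl → b≢d refl }

-- Paths and iterates of a map.

module _ {A : Set} {R : A → A → Set} where

  path-applyUpTo : ∀ f → (∀ i → R (f i) (f (suc i))) → ∀ n → Path R (applyUpTo f n)
  path-applyUpTo f r zero          = path[]
  path-applyUpTo f r (suc zero)    = path[ f 0 ]
  path-applyUpTo f r (suc (suc n)) = path∷ (r 0) (path-applyUpTo (f ∘ suc) (r ∘ suc) (suc n))

  path-∷ʳ : ∀ {x xs y} → Path R (x ∷ xs) → R (lastOf x xs) y → Path R (x ∷ xs ++ [ y ])
  path-∷ʳ path[ x ]   s = path∷ s path[ _ ]
  path-∷ʳ (path∷ r p) s = path∷ r (path-∷ʳ p s)

lastOf-applyUpTo : ∀ {A : Set} (f : ℕ → A) n → lastOf (f 0) (applyUpTo (f ∘ suc) n) ≡ f n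
lastOf-applyUpTo f zero    = refl
lastOf-applyUpTo f (suc n) = lastOf-applyUpTo (f ∘ suc) n

infix 9 _^[_]_
_^[_]_ : {A : Set} → (A → A) → ℕ → A → A
f ^[ zero ] x  = x
f ^[ suc k ] x = f (f ^[ k ] x)

^-+ : ∀ {A : Set} (f : A → A) i j x → f ^[ i + j ] x ≡ f ^[ i ] (f ^[ j ] x)
^-+ f zero    j x = refl
^-+ f (suc i) j x = cong f (^-+ f i j x)

^-injective : ∀ {A : Set} {f : A → A} → (∀ {x y} → f x ≡ f y → x ≡ y) →
              ∀ i {x y} → f ^[ i ] x ≡ f ^[ i ] y → x ≡ y
^-injective inj zero    eq = eq
^-injective inj (suc i) eq = ^-injective inj i (inj eq)

-- Gluing the cycles of a permutation.

module Gluing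
  {V : Set} (_≟ᵛ_ : DecidableEquality V)
  (F : V → V) (F-injective : ∀ {v w} → F v ≡ F w → v ≡ w)
  (periodic : ∀ v → ∃ λ k → F ^[ suc k ] v ≡ v)
  (R : V → V → Set) (R-sym : ∀ {v w} → R v w → R w v) (R-F : ∀ v → R v (F v))
  (side : V → Bool) (side-F : ∀ v → side (F v) ≡ not (side v))
  -- G x y makes x, F y, y, F⁵ x, F⁶ x, F x a 6-cycle in which every other edge belongs to F.
  (G : V → V → Set)
  (G-unique : ∀ {x x′ y} → G x y → G x′ y → x ≡ x′)
  (G-sideˡ : ∀ {x y} → G x y → side x ≡ true)
  (G-sideʳ : ∀ {x y} → G x y → side y ≡ true)
  (G-≢ : ∀ {x y x′ y′} → G x y → G x′ y′ → y ≢ x′)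
  (G-period : ∀ {x y} → G x y → ∀ i → i < 5 → F ^[ i ] (F x) ≢ x)
  (G-R₁ : ∀ {x y} → G x y → R y (F ^[ 4 ] (F x)))
  (G-R₂ : ∀ {x y} → G x y → R (F x) (F ^[ 5 ] (F x)))
  (G-R₃ : ∀ {x y} → G x y → R x (F y))
  where

  open DecMembership _≟ᵛ_ using (_∈?_)

  module Orbit (a : V) where

    private
      period : ∃ λ k → F ^[ suc k ] a ≡ a × (∀ i → i < k → F ^[ suc i ] a ≢ a)
      period = least (λ i → (F ^[ suc i ] a) ≟ᵛ a) {proj₁ (periodic a)} (proj₂ (periodic a))

    -- One less than the period of `a`, so that `orbit` is visibly non-empty and `F ^[ k ] a` is the
    -- predecessor of `a`.
    k : ℕ
    k = proj₁ period

    returns : F ^[ suc k ] a ≡ a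
    returns = proj₁ (proj₂ period)

    orbit : List V
    orbit = applyUpTo (λ i → F ^[ i ] a) (suc k)

    orbit-unique : Unique orbit
    -- Cancelling `F ^[ i ]` in a repetition gives a return to `a` before the period.
    orbit-unique = Unique.applyUpTo⁺₁ _ (suc k) λ {i} {j} i<j j<1+k eq →
      case m≤n⇒∃[o]m+o≡n i<j of λ where
        (d , refl) → proj₂ (proj₂ period) d
          (≤-trans (s≤s (m≤n+m d i)) (s≤s⁻¹ j<1+k))
          (sym (^-injective F-injective i
            (trans eq (trans (cong (λ m → F ^[ m ] a) (sym (+-suc i d))) (^-+ F i (suc d) a)))))

    ∈-orbit⁻ : ∀ {v} → v ∈ orbit → ∃ λ i → i < suc k × v ≡ F ^[ i ] a
    ∈-orbit⁻ = ∈-applyUpTo⁻ (λ i → F ^[ i ] a) {n = suc k}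

    orbit-F⁺ : ∀ {v} → v ∈ orbit → F v ∈ orbit
    orbit-F⁺ v∈ with ∈-orbit⁻ v∈
    ... | i , i<1+k , refl with m≤n⇒m<n∨m≡n (s≤s⁻¹ i<1+k)
    ...   | inj₁ i<k  = ∈-applyUpTo⁺ (λ i → F ^[ i ] a) (s≤s i<k)
    ...   | inj₂ refl = here returns

    orbit-F⁻ : ∀ {v} → F v ∈ orbit → v ∈ orbit
    orbit-F⁻ Fv∈ with ∈-orbit⁻ Fv∈
    ... | zero  , _     , eq = subst (_∈ orbit) (F-injective (trans returns (sym eq)))
                                 (∈-applyUpTo⁺ (λ i → F ^[ i ] a) (n<1+n k))
    ... | suc i , i<1+k , eq = subst (_∈ orbit) (sym (F-injective eq))
                                 (∈-applyUpTo⁺ (λ i → F ^[ i ] a) (<-trans (n<1+n i) i<1+k))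

    -- `P` is passed back along `F` until it reaches `a`. With membership in a tour for `P`, an
    -- orbit that meets the tour has its base point there.
    orbit-⊆ : (P : V → Set) → (∀ {v} → P (F v) → P v) → ∀ {v} → v ∈ orbit → P v → P a
    orbit-⊆ P P-F v∈ with ∈-orbit⁻ v∈
    ... | i , _ , refl = go i
      where
      go : ∀ i → P (F ^[ i ] a) → P a
      go zero    p = p
      go (suc i) p = go i (P-F p)

  -- The vertex set stays a union of `F`-orbits, so that an orbit still to be glued in is disjoint
  -- from it. The closing edge is kept apart: `free` asks for an edge inside the list, where
  -- `insert` can open it.
  record Tour : Set where
    field
      start   : V
      rest    : List V

    vertices : List V
    vertices = start ∷ rest

    field
      unique  : Unique vertices
      path    : Path R vertices
      closing : R (lastOf start rest) start
      F⁺      : ∀ {v} → v ∈ vertices → F v ∈ vertices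
      F⁻      : ∀ {v} → F v ∈ vertices → v ∈ vertices
      -- The edge at which a vertex x outside the tour could be glued in has not been removed.
      free    : ∀ {x y} → G x y → x ∉ vertices → y ∈ vertices → Edge y (F y) vertices

  open Tour

  orbitTour : ∀ a → side a ≡ true → Tour
  orbitTour a a-side = record
    { start   = a
    ; rest    = applyUpTo (λ i → F ^[ suc i ] a) k
    ; unique  = orbit-unique
    ; path    = path-applyUpTo (λ i → F ^[ i ] a) (λ _ → R-F _) (suc k)
    ; closing = subst (λ v → R v a) (sym (lastOf-applyUpTo (λ i → F ^[ i ] a) k))
                  (subst (R _) returns (R-F _))
    ; F⁺      = orbit-F⁺
    ; F⁻      = orbit-F⁻
    ; free    = free′
    }
    where
    open Orbit a
    free′ : ∀ {x y} → G x y → x ∉ orbit → y ∈ orbit → Edge y (F y) orbit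
    free′ g _ y∈ with ∈-orbit⁻ y∈
    ... | i , i<1+k , refl with m≤n⇒m<n∨m≡n (s≤s⁻¹ i<1+k)
    ...   | inj₁ i<k  = inj₁ (link-applyUpTo (λ i → F ^[ i ] a) (suc k) (s≤s i<k))
    -- The one edge of the orbit outside the list starts at `F ^[ k ] a`, which has side `false` and
    -- so is no right-hand vertex of `G`.
    ...   | inj₂ refl = contradiction
            (trans (sym a-side) (trans (cong side (sym returns)) (trans (side-F _) (cong not (G-sideʳ g)))))
            λ ()

  module Glue (T : Tour) {x y} (g : G x y) (x∉T : x ∉ vertices T) (y∈T : y ∈ vertices T) where

    private
      a = F x
      open Orbit a

      Fᵏa≡x : F ^[ k ] a ≡ x
      Fᵏa≡x = F-injective returns

      -- Hence `window`, consisting of F x, ..., F⁵ x, leaves at least `x` for `tail`.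
      k≥5 : 5 ≤ k
      k≥5 = ≮⇒≥ λ k<5 → G-period g k k<5 Fᵏa≡x

      k′ : ℕ
      k′ = proj₁ (m≤n⇒∃[o]m+o≡n k≥5)

      5+k′≡k : 5 + k′ ≡ k
      5+k′≡k = proj₂ (m≤n⇒∃[o]m+o≡n k≥5)

      -- The orbit of x cut open along the 6-cycle: F⁵ x, …, F x, F⁶ x, F⁷ x, …, x.
      window tail segment : List V
      window  = applyUpTo (λ i → F ^[ i ] a) 5
      tail    = applyUpTo (λ i → F ^[ 5 + i ] a) (suc k′)
      segment = reverse window ++ tail

      segment↭orbit : segment ↭ orbit
      segment↭orbit = ↭-trans (++⁺ʳ tail (↭-reverse window))
        (↭-reflexive (cong (λ m → applyUpTo (λ i → F ^[ i ] a) (suc m)) 5+k′≡k))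

      tail-last : lastOf (F ^[ 5 ] a) (applyUpTo (λ i → F ^[ 6 + i ] a) k′) ≡ x
      tail-last = trans (lastOf-applyUpTo (λ i → F ^[ 5 + i ] a) k′)
        (trans (cong (λ m → F ^[ m ] a) 5+k′≡k) Fᵏa≡x)

      -- The three edges of the 6-cycle outside `F` join `y` to F⁵ x, the end F x of the reversed
      -- window to F⁶ x, and the last vertex `x` to `F y`. All other steps are edges of `F`,
      -- traversed backwards in the window.
      segment-path : Path R (y ∷ segment ++ [ F y ])
      segment-path =
        path∷ (G-R₁ g) (path∷ (R-sym (R-F _)) (path∷ (R-sym (R-F _)) (path∷ (R-sym (R-F _)) (path∷ (R-sym (R-F _))
          (path∷ (G-R₂ g)
            (path-∷ʳ (path-applyUpTo (λ i → F ^[ 5 + i ] a) (λ _ → R-F _) (suc k′))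
              (subst (λ v → R v (F y)) (sym tail-last) (G-R₃ g))))))))

      ¬side : ∀ {v} → side v ≡ true → ¬ side (F v) ≡ true
      ¬side {v} p q with () ← trans (sym q) (trans (side-F v) (cong not p))

      side-F² : ∀ v → side v ≡ true → side (F (F v)) ≡ true
      side-F² v p = trans (side-F (F v)) (trans (cong not (side-F v)) (trans (not-involutive _) p))

      -- The orbit loses the edges from F⁵ x to F⁶ x and from `x` to F x. The first starts on the
      -- side `false`, the second at `x`, which `G-≢` keeps from being a right-hand vertex; so no
      -- later gluing needs them.
      segment-edge : ∀ {x′ y′} → G x′ y′ → y′ ∈ segment → Edge y′ (F y′) segment
      segment-edge g′ y′∈ with ∈-orbit⁻ (∈-resp-↭ segment↭orbit y′∈)
      ... | 0 , _ , refl = contradiction (G-sideʳ g′) (¬side (G-sideˡ g))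
      ... | 1 , _ , refl = inj₂ (there (there here))
      ... | 2 , _ , refl = contradiction (G-sideʳ g′) (¬side (side-F² _ (G-sideˡ g)))
      ... | 3 , _ , refl = inj₂ here
      ... | 4 , _ , refl = contradiction (G-sideʳ g′) (¬side (side-F² _ (side-F² _ (G-sideˡ g))))
      ... | suc (suc (suc (suc (suc i)))) , i<1+k , refl
              with m≤n⇒m<n∨m≡n (subst (5 + i ≤_) (sym 5+k′≡k) (s≤s⁻¹ i<1+k))
      ...   | inj₁ i<k = edge-++ʳ (reverse window)
                (inj₁ (link-applyUpTo (λ i → F ^[ 5 + i ] a) (suc k′) (s≤s (+-cancelˡ-< 5 i k′ i<k))))
      ...   | inj₂ eq = contradiction (trans (cong (λ m → F ^[ m ] a) (trans eq 5+k′≡k)) Fᵏa≡x) (G-≢ g′ g)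

      -- A common vertex would bring F x, and therefore `x`, into the tour.
      disjoint : ∀ {v} → v ∈ vertices T → v ∉ segment
      disjoint v∈T v∈ = x∉T (F⁻ T (orbit-⊆ (_∈ vertices T) (F⁻ T) (∈-resp-↭ segment↭orbit v∈) v∈T))

      -- The edge opened in the tour serves no other gluing: `F y` lies on the wrong side, and at
      -- `y` only `x` can be glued in.
      y-only : ∀ {x′ y′ v} → G x′ y′ → y′ ≡ v → v ≡ y ⊎ v ≡ F y → x′ ≡ x
      y-only g′ refl (inj₁ refl) = G-unique g′ g
      y-only g′ refl (inj₂ refl) = contradiction (G-sideʳ g′) (¬side (G-sideʳ g))

      -- The tour may pass the edge between `y` and `F y` in either direction, so `zs` stands for
      -- `segment` or its reverse.
      module Insert (u v : V) (zs : List V) (zs↭segment : zs ↭ segment)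
               (zs-path : Path R (u ∷ zs ++ [ v ]))
               (zs-edge : ∀ {x′ y′} → G x′ y′ → y′ ∈ segment → Edge y′ (F y′) zs)
               (u≡ : u ≡ y ⊎ u ≡ F y) (v≡ : v ≡ y ⊎ v ≡ F y)
               (l : Link u v (vertices T)) where

        new : List V
        new = start T ∷ insert l zs

        new↭ : new ↭ zs ++ vertices T
        new↭ = insert-↭ zs l

        ∈-new⁻ : ∀ {w} → w ∈ new → w ∈ orbit ⊎ w ∈ vertices T
        ∈-new⁻ w∈ with ∈-++⁻ zs (∈-resp-↭ new↭ w∈)
        ... | inj₁ w∈zs = inj₁ (∈-resp-↭ segment↭orbit (∈-resp-↭ zs↭segment w∈zs))
        ... | inj₂ w∈T  = inj₂ w∈T

        ∈-new⁺ᵒ : ∀ {w} → w ∈ orbit → w ∈ new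
        ∈-new⁺ᵒ w∈ = ∈-resp-↭ (↭-sym new↭)
          (∈-++⁺ˡ (∈-resp-↭ (↭-sym zs↭segment) (∈-resp-↭ (↭-sym segment↭orbit) w∈)))

        ∈-new⁺ᵗ : ∀ {w} → w ∈ vertices T → w ∈ new
        ∈-new⁺ᵗ w∈ = ∈-resp-↭ (↭-sym new↭) (∈-++⁺ʳ zs w∈)

        x∈new : x ∈ new
        x∈new = ∈-new⁺ᵒ (orbit-F⁻ (here refl))

        glued : Tour
        glued = record
          { start   = start T
          ; rest    = insert l zs
          ; unique  = unique-resp-↭ (↭-sym new↭)
              (Unique.++⁺ (unique-resp-↭ (↭-sym (↭-trans zs↭segment segment↭orbit)) orbit-unique)
                (unique T) λ (p , q) → disjoint q (∈-resp-↭ zs↭segment p))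
          ; path    = insert-path zs l zs-path (path T)
          ; closing = subst (λ w → R w (start T)) (sym (insert-lastOf zs l)) (closing T)
          ; F⁺      = λ w∈ → case ∈-new⁻ w∈ of λ where
              (inj₁ w∈O) → ∈-new⁺ᵒ (orbit-F⁺ w∈O)
              (inj₂ w∈T) → ∈-new⁺ᵗ (F⁺ T w∈T)
          ; F⁻      = λ w∈ → case ∈-new⁻ w∈ of λ where
              (inj₁ w∈O) → ∈-new⁺ᵒ (orbit-F⁻ w∈O)
              (inj₂ w∈T) → ∈-new⁺ᵗ (F⁻ T w∈T)
          ; free    = free′
          }
          where
          free′ : ∀ {x′ y′} → G x′ y′ → x′ ∉ new → y′ ∈ new → Edge y′ (F y′) new
          free′ {x′} g′ x′∉ y′∈ with ∈-new⁻ y′∈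
          free′ {x′} g′ x′∉ y′∈ | inj₁ y′∈O with zs-edge g′ (∈-resp-↭ (↭-sym segment↭orbit) y′∈O)
          ... | inj₁ k = inj₁ (insert-linkⁿ zs l k)
          ... | inj₂ k = inj₂ (insert-linkⁿ zs l k)
          free′ {x′} g′ x′∉ y′∈ | inj₂ y′∈T with free T g′ (x′∉ ∘ ∈-new⁺ᵗ) y′∈T
          free′ {x′} g′ x′∉ y′∈ | inj₂ y′∈T | inj₁ k with insert-linkᵒ zs l k
          ... | inj₁ k′ = inj₁ k′
          ... | inj₂ eq = contradiction (subst (_∈ new) (sym (y-only g′ (proj₁ eq) u≡)) x∈new) x′∉
          free′ {x′} g′ x′∉ y′∈ | inj₂ y′∈T | inj₂ k with insert-linkᵒ zs l k
          ... | inj₁ k′ = inj₂ k′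
          ... | inj₂ eq = contradiction (subst (_∈ new) (sym (y-only g′ (proj₂ eq) v≡)) x∈new) x′∉

    glue : ∃ λ T′ → (∀ {v} → v ∈ vertices T → v ∈ vertices T′) × x ∈ vertices T′
    glue with free T g x∉T y∈T
    ... | inj₁ l = glued , ∈-new⁺ᵗ , x∈new
      where open Insert y (F y) segment ↭-refl segment-path segment-edge (inj₁ refl) (inj₂ refl) l
    ... | inj₂ l = glued , ∈-new⁺ᵗ , x∈new
      where
      reverse-path : Path R (F y ∷ reverse segment ++ [ y ])
      reverse-path = subst (Path R)
        (trans (unfold-reverse y (segment ++ [ F y ])) (cong (_++ [ y ]) (reverse-++ segment [ F y ])))
        (path-reverse R-sym segment-path)
      open Insert (F y) y (reverse segment) (↭-reverse segment) reverse-path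
        (λ g′ y′∈ → edge-reverse (segment-edge g′ y′∈)) (inj₂ refl) (inj₁ refl) l

-- Cyclic shifts of lists and changes of a single entry.

^-suc : ∀ {A : Set} (f : A → A) k x → f ^[ suc k ] x ≡ f ^[ k ] (f x)
^-suc f zero    x = refl
^-suc f (suc k) x = cong f (^-suc f k x)

module _ {A : Set} where

  rotl : List A → List A
  rotl []       = []
  rotl (x ∷ xs) = xs ++ [ x ]

  rotl-++ : ∀ (xs : List A) ys → rotl ^[ length xs ] (xs ++ ys) ≡ ys ++ xs
  rotl-++ []       ys = sym (++-identityʳ ys)
  rotl-++ (x ∷ xs) ys = begin
    rotl ^[ suc (length xs) ] (x ∷ xs ++ ys)   ≡⟨ ^-suc rotl (length xs) _ ⟩
    rotl ^[ length xs ] ((xs ++ ys) ++ [ x ])  ≡⟨ cong (rotl ^[ length xs ]_) (++-assoc xs ys [ x ]) ⟩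
    rotl ^[ length xs ] (xs ++ ys ++ [ x ])    ≡⟨ rotl-++ xs (ys ++ [ x ]) ⟩
    (ys ++ [ x ]) ++ xs                        ≡⟨ ++-assoc ys [ x ] xs ⟩
    ys ++ x ∷ xs                               ∎
    where open ≡-Reasoning

  rotl-length : ∀ (xs : List A) → rotl ^[ length xs ] xs ≡ xs
  rotl-length xs = trans (cong (rotl ^[ length xs ]_) (sym (++-identityʳ xs))) (rotl-++ xs [])

  data Flip : List A → List A → Set where
    here  : ∀ {x y xs} → x ≢ y → Flip (x ∷ xs) (y ∷ xs)
    there : ∀ {x xs ys} → Flip xs ys → Flip (x ∷ xs) (x ∷ ys)

  flip-sym : ∀ {xs ys} → Flip xs ys → Flip ys xs
  flip-sym (here x≢y) = here (x≢y ∘ sym)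
  flip-sym (there f)  = there (flip-sym f)

  flip-++ˡ : ∀ {xs ys} zs → Flip xs ys → Flip (xs ++ zs) (ys ++ zs)
  flip-++ˡ zs (here x≢y) = here x≢y
  flip-++ˡ zs (there f)  = there (flip-++ˡ zs f)

  flip-++ʳ : ∀ {xs ys} zs → Flip xs ys → Flip (zs ++ xs) (zs ++ ys)
  flip-++ʳ []       f = f
  flip-++ʳ (z ∷ zs) f = there (flip-++ʳ zs f)

  flip-rotl : ∀ {xs ys} → Flip xs ys → Flip (rotl xs) (rotl ys)
  flip-rotl (here {xs = xs} x≢y) = flip-++ʳ xs (here x≢y)
  flip-rotl (there f)            = flip-++ˡ _ f

  flip-rotl^ : ∀ {xs ys} k → Flip xs ys → Flip (rotl ^[ k ] xs) (rotl ^[ k ] ys)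
  flip-rotl^ zero    f = f
  flip-rotl^ (suc k) f = flip-rotl (flip-rotl^ k f)

length-rotl : ∀ {A : Set} k (xs : List A) → length (rotl ^[ k ] xs) ≡ length xs
length-rotl zero    xs = refl
length-rotl (suc k) xs = trans (length-rotl₁ (rotl ^[ k ] xs)) (length-rotl k xs)
  where
  length-rotl₁ : ∀ xs → length (rotl xs) ≡ length xs
  length-rotl₁ []       = refl
  length-rotl₁ (x ∷ xs) = trans (length-++ xs) (+-comm _ 1)

-- Subtraction of 1 modulo `suc m`.
prev : ∀ {m} → Fin (suc m) → Fin (suc m)
prev {m} zero = fromℕ m
prev (suc i)  = inject₁ i

prev-injective : ∀ {m} (i j : Fin (suc m)) → prev i ≡ prev j → i ≡ j
prev-injective zero    zero    _  = refl
prev-injective zero    (suc j) eq = contradiction eq Fin.fromℕ≢inject₁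
prev-injective (suc i) zero    eq = contradiction (sym eq) Fin.fromℕ≢inject₁
prev-injective (suc i) (suc j) eq = cong suc (Fin.inject₁-injective eq)

-- Modulo a number that is at least 3, subtracting 2 has no fixed point.
prev²≢ : ∀ {k} → 2 ≤ k → (i : Fin (suc k)) → prev (prev i) ≢ i
prev²≢ (s≤s (s≤s _)) zero          ()
prev²≢ (s≤s (s≤s _)) (suc zero)    ()
prev²≢ (s≤s (s≤s _)) (suc (suc i)) eq =
  contradiction (trans (sym (trans (Fin.toℕ-inject₁ (inject₁ i)) (Fin.toℕ-inject₁ i))) (cong toℕ eq))
    (<⇒≢ (m<n⇒m<1+n (n<1+n (toℕ i))))

-- Shifts count modulo the length: at `zero` the wrap-around adds a full turn, which is the
-- identity.
rotl-prev : ∀ {A : Set} {m} (xs : List A) → length xs ≡ suc m → ∀ (i : Fin (suc m)) →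
            rotl ^[ toℕ (prev i) ] (rotl xs) ≡ rotl ^[ toℕ i ] xs
rotl-prev {m = m} xs eq zero = begin
  rotl ^[ toℕ (fromℕ m) ] (rotl xs)  ≡⟨ cong (λ k → rotl ^[ k ] (rotl xs)) (Fin.toℕ-fromℕ m) ⟩
  rotl ^[ m ] (rotl xs)              ≡⟨ ^-suc rotl m xs ⟨
  rotl ^[ suc m ] xs                 ≡⟨ cong (λ k → rotl ^[ k ] xs) eq ⟨
  rotl ^[ length xs ] xs             ≡⟨ rotl-length xs ⟩
  xs                                 ∎
  where open ≡-Reasoning
rotl-prev xs eq (suc i) =
  trans (cong (λ k → rotl ^[ k ] (rotl xs)) (Fin.toℕ-inject₁ i)) (sym (^-suc rotl (toℕ i) xs))

-- Dyck words.

word : Tree → List Bool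
word nil        = []
word (node u v) = true ∷ word u ++ false ∷ word v

word-⊕ : ∀ a b → word (a ⊕ b) ≡ word a ++ word b
word-⊕ nil        b = refl
word-⊕ (node u v) b = cong (true ∷_)
  (trans (cong (λ w → word u ++ false ∷ w) (word-⊕ v b)) (sym (++-assoc (word u) (false ∷ word v) (word b))))

length-word : ∀ t → length (word t) ≡ 2 * size t
length-word nil        = refl
length-word (node u v) = begin
  suc (length (word u ++ false ∷ word v))          ≡⟨ cong suc (length-++ (word u)) ⟩
  suc (length (word u) + suc (length (word v)))    ≡⟨ cong suc (+-suc _ _) ⟩
  suc (suc (length (word u) + length (word v)))
    ≡⟨ cong₂ (λ i j → 2 + (i + j)) (length-word u) (length-word v) ⟩
  suc (suc (2 * size u + 2 * size v))              ≡⟨ cong (2 +_) (*-distribˡ-+ 2 (size u) (size v)) ⟨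
  suc (suc (2 * (size u + size v)))                ≡⟨ *-suc 2 (size u + size v) ⟨
  2 * suc (size u + size v)                        ∎
  where open ≡-Reasoning

flip-▹ : ∀ u v → Flip ((word u ++ false ∷ word v) ++ [ false ]) (word (u ▹ v))
flip-▹ u v rewrite word-⊕ u (node v nil) | ++-assoc (word u) (false ∷ word v) [ false ] =
  flip-++ʳ (word u) (here λ ())

flip-rotate : ∀ t → Flip (word t ++ [ false ]) (true ∷ word (rotate t))
flip-rotate nil        = here λ ()
flip-rotate (node u v) = there (flip-▹ u v)

-- The trees of height at most `n` when read as binary trees. A finite list that includes all trees
-- of size `n` is enough, both for the pigeonhole argument and for running through the trees.
trees : ℕ → List Tree
trees zero    = nil ∷ []
trees (suc n) = nil ∷ cartesianProductWith node (trees n) (trees n)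

∈-trees : ∀ n t → size t ≤ n → t ∈ trees n
∈-trees zero    nil        _       = here refl
∈-trees (suc n) nil        _       = here refl
∈-trees (suc n) (node u v) (s≤s p) = there (∈-cartesianProductWith⁺ node
  (∈-trees n u (m+n≤o⇒m≤o (size u) p)) (∈-trees n v (m+n≤o⇒n≤o (size u) p)))

-- The cycle factor and its 6-cycles.

module _ (n : ℕ) where

  -- B t s is named after its predecessor A t s in the cycle factor, hence the rotate in emb.
  data Vertex : Set where
    A B : (t : Tree) → .(size t ≡ n) → Fin (suc (2 * n)) → Vertex

module _ {n : ℕ} where

  abstract

    infix 4 _≟ᵛ_
    _≟ᵛ_ : DecidableEquality (Vertex n)
    A _ _ _ ≟ᵛ B _ _ _ = no λ ()
    B _ _ _ ≟ᵛ A _ _ _ = no λ ()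
    A t _ s ≟ᵛ A t′ _ s′ with t ≟ᵗ t′ | s Fin.≟ s′
    ... | yes refl | yes refl = yes refl
    ... | no t≢t′  | _        = no λ { refl → t≢t′ refl }
    ... | yes _    | no s≢s′  = no λ { refl → s≢s′ refl }
    B t _ s ≟ᵛ B t′ _ s′ with t ≟ᵗ t′ | s Fin.≟ s′
    ... | yes refl | yes refl = yes refl
    ... | no t≢t′  | _        = no λ { refl → t≢t′ refl }
    ... | yes _    | no s≢s′  = no λ { refl → s≢s′ refl }

  -- The shift drops by one in the second clause because one `rotl` turns 0 r(w) into r(w) 0.
  F : Vertex n → Vertex n
  F (A t p s) = B t p s
  F (B t p s) = A (rotate t) (trans (size-rotate t) p) (prev s)

  abstract

    F-injective : ∀ {v w} → F v ≡ F w → v ≡ w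
    F-injective {A t p s} {A t′ p′ s′} refl = refl
    F-injective {B t p s} {B t′ p′ s′} eq = lemma t t′ (A-injective eq)
      where
      A-injective : ∀ {a b s s′} .{p : size a ≡ n} .{q : size b ≡ n} → A a p s ≡ A b q s′ → a ≡ b × s ≡ s′
      A-injective refl = refl , refl
      lemma : ∀ a b {s s′} .{p : size a ≡ n} .{q : size b ≡ n} → rotate a ≡ rotate b × prev s ≡ prev s′ →
              B a p s ≡ B b q s′
      lemma a b {s} {s′} (e , e′) with refl ← rotate-injective a b e | refl ← prev-injective s s′ e′ = refl

  emb : Vertex n → List Bool
  emb (A t _ s) = rotl ^[ toℕ s ] (word t ++ [ false ])
  emb (B t _ s) = rotl ^[ toℕ s ] (true ∷ word (rotate t))

  sized : ∀ t → .(size t ≡ n) → size t ≡ n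
  sized t p = recompute (size t ≟ n) p

  length-emb : ∀ v → length (emb v) ≡ suc (2 * n)
  length-emb (A t p s) = trans (length-rotl (toℕ s) (word t ++ [ false ]))
    (trans (length-++ (word t)) (trans (+-comm _ 1) (cong suc (trans (length-word t) (cong (2 *_) (sized t p))))))
  length-emb (B t p s) = trans (length-rotl (toℕ s) (true ∷ word (rotate t)))
    (cong suc (trans (length-word (rotate t)) (cong (2 *_) (trans (size-rotate t) (sized t p)))))

  Adj : Vertex n → Vertex n → Set
  Adj v w = Flip (emb v) (emb w)

  abstract

    adj-F : ∀ v → Adj v (F v)
    adj-F (A t p s) = flip-rotl^ (toℕ s) (flip-rotate t)
    adj-F (B t p s) = subst (Flip _)
      (sym (rotl-prev (false ∷ word (rotate t))
        (cong suc (trans (length-word (rotate t)) (cong (2 *_) (trans (size-rotate t) (sized t p))))) s))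
      (flip-rotl^ (toℕ s) (here λ ()))

  -- Up to the common shift `s`, the 6-cycle x, F y, y, F⁵ x, F⁶ x, F x reads 110u0v0, 111u0v0,
  -- 101u0v0, 101u1v0, 100u1v0, 110u1v0: three positions, each flipped twice.
  data Glueable : Vertex n → Vertex n → Set where
    glueable : ∀ u v .p .q s →
      Glueable (A (node (node nil u) v) p s) (A (node nil (node u v)) q s)

  -- Shifted by `s`, `X` is F⁵ x for `b = true` and F⁶ x for `b = false`. The map `emb` presents
  -- these vertices with the shifts s - 2 and s - 3, whence the two lemmas.
  module _ (u v : Tree) (s : Fin (suc (2 * n))) (b : Bool) where
    private
      X : List Bool
      X = true ∷ false ∷ b ∷ word (u ▹ v)

      rotl²X : rotl (rotl X) ≡ b ∷ word ((u ▹ v) ▹ nil)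
      rotl²X = cong (b ∷_) (trans (++-assoc (word (u ▹ v)) [ true ] [ false ])
                                  (sym (word-⊕ (u ▹ v) (node nil nil))))

      lengthX : size (node (node nil u) v) ≡ n → length X ≡ suc (2 * n)
      lengthX p = cong suc (trans (cong (λ k → 2 + k) (trans (length-word (u ▹ v)) (cong (2 *_) (size-▹ u v))))
        (trans (sym (*-suc 2 (suc (size u + size v)))) (cong (2 *_) p)))

    rotl-prev² : size (node (node nil u) v) ≡ n →
      rotl ^[ toℕ (prev (prev s)) ] (b ∷ word ((u ▹ v) ▹ nil)) ≡ rotl ^[ toℕ s ] X
    rotl-prev² p = begin
      rotl ^[ toℕ (prev (prev s)) ] (b ∷ word ((u ▹ v) ▹ nil))
        ≡⟨ cong (rotl ^[ toℕ (prev (prev s)) ]_) rotl²X ⟨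
      rotl ^[ toℕ (prev (prev s)) ] (rotl (rotl X))
        ≡⟨ rotl-prev (rotl X) (trans (length-rotl 1 X) (lengthX p)) (prev s) ⟩
      rotl ^[ toℕ (prev s) ] (rotl X)                           ≡⟨ rotl-prev X (lengthX p) s ⟩
      rotl ^[ toℕ s ] X                                         ∎
      where open ≡-Reasoning

    rotl-prev³ : size (node (node nil u) v) ≡ n →
      rotl ^[ toℕ (prev (prev (prev s))) ] (word ((u ▹ v) ▹ nil) ++ [ b ]) ≡ rotl ^[ toℕ s ] X
    rotl-prev³ p = trans
      (rotl-prev (b ∷ word ((u ▹ v) ▹ nil))
        (trans (cong length (sym rotl²X)) (trans (length-rotl 2 X) (lengthX p)))
        (prev (prev s)))
      (rotl-prev² p)

  abstract

    glueable-adj₁ : ∀ {x y} → Glueable x y → Adj y (F ^[ 4 ] (F x))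
    glueable-adj₁ (glueable u v p q s) = subst (Flip _) (sym (rotl-prev² u v s true (sized (node (node nil u) v) p)))
      (flip-rotl^ (toℕ s) (there (there (there (flip-▹ u v)))))

    glueable-adj₂ : ∀ {x y} → Glueable x y → Adj (F x) (F ^[ 5 ] (F x))
    glueable-adj₂ (glueable u v p q s) = subst (Flip _) (sym (rotl-prev³ u v s false (sized (node (node nil u) v) p)))
      (flip-rotl^ (toℕ s) (there (here λ ())))

    glueable-adj₃ : ∀ {x y} → Glueable x y → Adj x (F y)
    glueable-adj₃ (glueable u v p q s) = flip-rotl^ (toℕ s) (there (there (here λ ())))

    -- For even `i` the vertex is a `B`. For `i = 1` its tree has an empty first subtree, unlike the
    -- tree of `x`.
    glueable-period : ∀ {x y} → Glueable x y → ∀ i → i < 5 → F ^[ i ] (F x) ≢ x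
    glueable-period (glueable u v p q s) 0 _ ()
    glueable-period (glueable u v p q s) 1 _ ()
    glueable-period (glueable u v p q s) 2 _ ()
    -- F⁴ x may have the same tree as x, but its shift differs by two.
    glueable-period (glueable u v p q s) 3 _ eq = prev²≢
      (*-monoʳ-≤ 2 {1} (subst (1 ≤_) (sized (node (node nil u) v) p) (s≤s z≤n))) s (shift-injective eq)
      where
      shift-injective : ∀ {a b s s′} .{p : size a ≡ n} .{q : size b ≡ n} → A a p s ≡ A b q s′ → s ≡ s′
      shift-injective refl = refl
    glueable-period (glueable u v p q s) 4 _ ()
    glueable-period (glueable u v p q s) (suc (suc (suc (suc (suc i))))) (s≤s (s≤s (s≤s (s≤s (s≤s ())))))

  side : Vertex n → Bool
  side (A _ _ _) = true
  side (B _ _ _) = false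

  abstract

    side-F : ∀ v → side (F v) ≡ not (side v)
    side-F (A _ _ _) = refl
    side-F (B _ _ _) = refl

  private
    treeIndex : ∀ t → .(size t ≡ n) → Fin (length (trees n))
    treeIndex t p = index (∈-trees n t (≤-reflexive (sized t p)))

    code : Vertex n → Fin (2 * (length (trees n) * suc (2 * n)))
    code (A t p s) = combine {2} zero       (combine (treeIndex t p) s)
    code (B t p s) = combine {2} (suc zero) (combine (treeIndex t p) s)

    combine-treeIndex-injective : ∀ t t′ .(p : size t ≡ n) .(p′ : size t′ ≡ n) (s s′ : Fin (suc (2 * n))) →
      combine (treeIndex t p) s ≡ combine (treeIndex t′ p′) s′ → t ≡ t′ × s ≡ s′
    combine-treeIndex-injective t t′ p p′ s s′ eq
      with e , e′ ← Fin.combine-injective (treeIndex t p) s (treeIndex t′ p′) s′ eq =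
      Membershipₛ.index-injective (setoid Tree) _ _ e , e′

    code-injective : ∀ v w → code v ≡ code w → v ≡ w
    code-injective (A t p s) (A t′ p′ s′) eq
      with refl , refl ← combine-treeIndex-injective t t′ p p′ s s′
                           (proj₂ (Fin.combine-injective {2} zero _ zero _ eq)) = refl
    code-injective (A t p s) (B t′ p′ s′) eq
      with () ← proj₁ (Fin.combine-injective {2} zero (combine (treeIndex t p) s) (suc zero) (combine (treeIndex t′ p′) s′) eq)
    code-injective (B t p s) (A t′ p′ s′) eq
      with () ← proj₁ (Fin.combine-injective {2} (suc zero) (combine (treeIndex t p) s) zero (combine (treeIndex t′ p′) s′) eq)
    code-injective (B t p s) (B t′ p′ s′) eq
      with refl , refl ← combine-treeIndex-injective t t′ p p′ s s′
                           (proj₂ (Fin.combine-injective {2} (suc zero) _ (suc zero) _ eq)) = refl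

  abstract

    -- By finiteness two iterates agree, and injectivity cancels the earlier one.
    periodic : ∀ v → ∃ λ k → F ^[ suc k ] v ≡ v
    periodic v with Fin.pigeonhole (n<1+n _) (λ i → code (F ^[ toℕ i ] v))
    ... | i , j , i<j , eq with d , 1+i+d≡j ← m≤n⇒∃[o]m+o≡n i<j =
      d , sym (^-injective F-injective (toℕ i) (begin
        F ^[ toℕ i ] v               ≡⟨ code-injective _ _ eq ⟩
        F ^[ toℕ j ] v               ≡⟨ cong (F ^[_] v) (trans (+-suc (toℕ i) d) 1+i+d≡j) ⟨
        F ^[ toℕ i + suc d ] v       ≡⟨ ^-+ F (toℕ i) (suc d) v ⟩
        F ^[ toℕ i ] (F ^[ suc d ] v) ∎))
      where open ≡-Reasoning

prev-surjective : ∀ {m} (i : Fin (suc m)) → ∃ λ j → prev j ≡ i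
prev-surjective i with view i
... | ‵fromℕ     = zero , refl
... | ‵inject₁ j = suc j , refl

-- Surjectivity of the embedding

-- The unmatched zeros and the unmatched ones after them cut a bitstring into Dyck words:
-- d 0 d₁ 0 … 0 dₖ 1 e₁ 1 … 1 eₗ.
separated : Tree → List Tree → List Tree → List Bool
suffix : List Tree → List Tree → List Bool
separated d ds es = word d ++ suffix ds es
suffix []       []       = []
suffix []       (e ∷ es) = true ∷ word e ++ suffix [] es
suffix (d ∷ ds) es       = false ∷ separated d ds es

-- Reading from the right, a new 1 is matched with the first unmatched 0, and stays unmatched if
-- there is none.
parse : ∀ xs → ∃ λ d → ∃₂ λ ds es → xs ≡ separated d ds es
parse []           = nil , [] , [] , refl
parse (false ∷ xs) with parse xs
... | d , ds , es , eq = nil , d ∷ ds , es , cong (false ∷_) eq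
parse (true ∷ xs) with parse xs
... | d , []      , es , eq = nil , [] , d ∷ es , cong (true ∷_) eq
... | d , d′ ∷ ds , es , eq = node d d′ , ds , es ,
  cong (true ∷_) (trans eq (sym (++-assoc (word d) (false ∷ word d′) (suffix ds es))))

suffix-∷ʳ : ∀ ds es e → suffix ds (es ∷ʳ e) ≡ suffix ds es ++ true ∷ word e
suffix-∷ʳ []       []        e = cong (true ∷_) (++-identityʳ (word e))
suffix-∷ʳ []       (e′ ∷ es) e = cong (true ∷_)
  (trans (cong (word e′ ++_) (suffix-∷ʳ [] es e)) (sym (++-assoc (word e′) (suffix [] es) (true ∷ word e))))
suffix-∷ʳ (d ∷ ds) es        e = cong (false ∷_)
  (trans (cong (word d ++_) (suffix-∷ʳ ds es e)) (sym (++-assoc (word d) (suffix ds es) (true ∷ word e))))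

data Canonical : List Bool → Set where
  isA : ∀ t → Canonical (word t ++ [ false ])
  isB : ∀ t → Canonical (true ∷ word t)

Rotated : List Bool → Set
Rotated xs = ∃₂ λ k ys → Canonical ys × xs ≡ rotl ^[ k ] ys

rotated-++ : ∀ xs ys → Rotated (xs ++ ys) → Rotated (ys ++ xs)
rotated-++ xs ys (k , zs , c , eq) = length xs + k , zs , c ,
  trans (sym (rotl-++ xs ys)) (trans (cong (rotl ^[ length xs ]_) eq) (sym (^-+ rotl (length xs) k zs)))

-- The cycle lemma. Moving the last block 1 e to the front matches its 1 with the first unmatched 0,
-- in 1 e d 0 d′. Both lists lose one entry, so their lengths keep differing by one, until a single
-- unmatched bit is left.
rotated-separated : ∀ d ds es →
  length ds ≡ suc (length es) ⊎ length es ≡ suc (length ds) → Rotated (separated d ds es)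
rotated-separated d [] []           (inj₁ ())
rotated-separated d [] []           (inj₂ ())
rotated-separated d [] (_ ∷ _ ∷ _)  (inj₁ ())
rotated-separated d [] (_ ∷ _ ∷ _)  (inj₂ ())
rotated-separated d [] (e ∷ [])     _  =
  subst Rotated (cong (λ w → word d ++ true ∷ w) (sym (++-identityʳ (word e))))
    (rotated-++ (true ∷ word e) (word d) (0 , _ , isB (e ⊕ d) , cong (true ∷_) (sym (word-⊕ e d))))
rotated-separated d (d′ ∷ ds) es eq with initLast es
rotated-separated d (d′ ∷ _ ∷ _) _ (inj₁ ()) | []
rotated-separated d (d′ ∷ _ ∷ _) _ (inj₂ ()) | []
rotated-separated d (d′ ∷ []) _ eq | [] =
  subst Rotated
    (trans (++-assoc (word d) [ false ] (word d′)) (cong (λ w → word d ++ false ∷ w) (sym (++-identityʳ (word d′)))))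
    (rotated-++ (word d′) (word d ++ [ false ])
      (0 , _ , isA (d′ ⊕ d) ,
       trans (sym (++-assoc (word d′) (word d) [ false ])) (cong (_++ [ false ]) (sym (word-⊕ d′ d)))))
rotated-separated d (d′ ∷ ds) _ eq | es ∷ʳ′ e =
  subst Rotated
    (trans (++-assoc (word d) (suffix (d′ ∷ ds) es) (true ∷ word e)) (cong (word d ++_) (sym (suffix-∷ʳ (d′ ∷ ds) es e))))
    (rotated-++ (true ∷ word e) (separated d (d′ ∷ ds) es)
      (subst Rotated matched (rotated-separated (node (e ⊕ d) d′) ds es lengths)))
  where
  matched : separated (node (e ⊕ d) d′) ds es ≡ (true ∷ word e) ++ separated d (d′ ∷ ds) es
  matched = cong (true ∷_) (begin
    (word (e ⊕ d) ++ false ∷ word d′) ++ suffix ds es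
      ≡⟨ ++-assoc (word (e ⊕ d)) (false ∷ word d′) (suffix ds es) ⟩
    word (e ⊕ d) ++ suffix (d′ ∷ ds) es                  ≡⟨ cong (_++ suffix (d′ ∷ ds) es) (word-⊕ e d) ⟩
    (word e ++ word d) ++ suffix (d′ ∷ ds) es            ≡⟨ ++-assoc (word e) (word d) (suffix (d′ ∷ ds) es) ⟩
    word e ++ separated d (d′ ∷ ds) es                   ∎)
    where open ≡-Reasoning

  length-∷ʳ : length (es ∷ʳ e) ≡ suc (length es)
  length-∷ʳ = trans (length-++ es) (+-comm (length es) 1)

  lengths : length ds ≡ suc (length es) ⊎ length es ≡ suc (length ds)
  lengths = case eq of λ where
    (inj₁ p) → inj₁ (trans (suc-injective p) length-∷ʳ)
    (inj₂ p) → inj₂ (suc-injective (trans (sym length-∷ʳ) p))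

trues : List Bool → ℕ
trues []           = 0
trues (true ∷ xs)  = suc (trues xs)
trues (false ∷ xs) = trues xs

trues-++ : ∀ xs ys → trues (xs ++ ys) ≡ trues xs + trues ys
trues-++ []           ys = refl
trues-++ (true ∷ xs)  ys = cong suc (trues-++ xs ys)
trues-++ (false ∷ xs) ys = trues-++ xs ys

trues-rotl : ∀ k xs → trues (rotl ^[ k ] xs) ≡ trues xs
trues-rotl zero    xs = refl
trues-rotl (suc k) xs = trans (trues-rotl₁ (rotl ^[ k ] xs)) (trues-rotl k xs)
  where
  trues-rotl₁ : ∀ xs → trues (rotl xs) ≡ trues xs
  trues-rotl₁ []       = refl
  trues-rotl₁ (x ∷ xs) = trans (trues-++ xs [ x ]) (trans (+-comm (trues xs) _) (sym (trues-++ [ x ] xs)))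

trues-word : ∀ t → trues (word t) ≡ size t
trues-word nil        = refl
trues-word (node u v) = cong suc (trans (trues-++ (word u) (false ∷ word v)) (cong₂ _+_ (trues-word u) (trues-word v)))

-- The string has k − l more zeros than ones.
Balance : ℕ → ℕ → List Bool → Set
Balance k l xs = length xs + l ≡ 2 * trues xs + k

balance-word : ∀ {k l} t xs → Balance k l xs → Balance k l (word t ++ xs)
balance-word {k} {l} t xs eq = begin
  length (word t ++ xs) + l
    ≡⟨ cong (_+ l) (trans (length-++ (word t)) (cong (_+ length xs) (length-word t))) ⟩
  2 * size t + length xs + l              ≡⟨ +-assoc (2 * size t) (length xs) l ⟩
  2 * size t + (length xs + l)            ≡⟨ cong (2 * size t +_) eq ⟩
  2 * size t + (2 * trues xs + k)         ≡⟨ +-assoc (2 * size t) (2 * trues xs) k ⟨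
  2 * size t + 2 * trues xs + k           ≡⟨ cong (_+ k) (*-distribˡ-+ 2 (size t) (trues xs)) ⟨
  2 * (size t + trues xs) + k
    ≡⟨ cong (λ m → 2 * m + k) (trans (trues-++ (word t) xs) (cong (_+ trues xs) (trues-word t))) ⟨
  2 * trues (word t ++ xs) + k            ∎
  where open ≡-Reasoning

balance-separated : ∀ d ds es → Balance (length ds) (length es) (separated d ds es)
balance-suffix : ∀ ds es → Balance (length ds) (length es) (suffix ds es)
balance-separated d ds es = balance-word d (suffix ds es) (balance-suffix ds es)
balance-suffix []       []       = refl
balance-suffix []       (e ∷ es) = begin
  suc (length xs) + suc (length es)  ≡⟨ cong suc (+-suc (length xs) (length es)) ⟩
  2 + (length xs + length es)        ≡⟨ cong (2 +_) (balance-word e (suffix [] es) (balance-suffix [] es)) ⟩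
  2 + (2 * trues xs + 0)             ≡⟨ cong (_+ 0) (*-suc 2 (trues xs)) ⟨
  2 * suc (trues xs) + 0             ∎
  where
  open ≡-Reasoning
  xs = word e ++ suffix [] es
balance-suffix (d ∷ ds) es       =
  trans (cong suc (balance-separated d ds es)) (sym (+-suc (2 * trues (separated d ds es)) (length ds)))

middle-lengths : ∀ {n k l} xs → Balance k l xs → length xs ≡ suc (2 * n) → trues xs ≡ n ⊎ trues xs ≡ suc n →
                 k ≡ suc l ⊎ l ≡ suc k
middle-lengths {n} {k} {l} xs bal len (inj₁ tr) rewrite len | tr =
  inj₁ (sym (+-cancelˡ-≡ (2 * n) (suc l) k (trans (+-suc (2 * n) l) bal)))
middle-lengths {n} {k} {l} xs bal len (inj₂ tr) rewrite len | tr =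
  inj₂ (+-cancelˡ-≡ (2 * n) l (suc k) (trans (suc-injective (trans bal (cong (_+ k) (*-suc 2 n)))) (sym (+-suc (2 * n) k))))

-- One more shift leads from `i` to its cyclic successor, the element whose `prev` is `i`.
rotl-toFin : ∀ {A : Set} {m} k (xs : List A) → length xs ≡ suc m →
             ∃ λ (i : Fin (suc m)) → rotl ^[ toℕ i ] xs ≡ rotl ^[ k ] xs
rotl-toFin zero    xs len = zero , refl
rotl-toFin (suc k) xs len with rotl-toFin k xs len
... | i , eq with j , refl ← prev-surjective i =
  j , trans (sym (rotl-prev xs len j)) (trans (sym (^-suc rotl (toℕ (prev j)) xs)) (cong rotl eq))

canonical-vertex : ∀ {n k ys} → Canonical ys → length ys ≡ suc (2 * n) →
                   ∃ λ (v : Vertex n) → emb v ≡ rotl ^[ k ] ys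
canonical-vertex {n} {k} {ys} c len with rotl-toFin k ys len | c
... | i , eq | isA t =
  A t (size≡ t (suc-injective (trans (+-comm 1 _) (trans (sym (length-++ (word t))) len)))) i , eq
  where
  size≡ : ∀ t → length (word t) ≡ 2 * n → size t ≡ n
  size≡ t e = *-cancelˡ-≡ (size t) n 2 (trans (sym (length-word t)) e)
... | i , eq | isB t with t′ , refl ← rotate-surjective t =
  B t′ (*-cancelˡ-≡ (size t′) n 2 (trans (cong (2 *_) (sym (size-rotate t′)))
    (trans (sym (length-word (rotate t′))) (suc-injective len)))) i , eq

emb-surjective : ∀ {n} xs → length xs ≡ suc (2 * n) → trues xs ≡ n ⊎ trues xs ≡ suc n →
                 ∃ λ (v : Vertex n) → emb v ≡ xs
emb-surjective xs len tr
  with d , ds , es , refl ← parse xs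
  with k , ys , c , eq ← rotated-separated d ds es
         (middle-lengths (separated d ds es) (balance-separated d ds es) len tr)
  with v , eq′ ← canonical-vertex {k = k} c (trans (sym (length-rotl k ys)) (trans (cong length (sym eq)) len)) =
  v , trans eq′ (sym eq)

-- Injectivity of the embedding

-- The zero behind `word t` is the first unmatched one of the string, which fixes where `word t`
-- ends.
word-++-injective : ∀ t t′ {xs xs′} → word t ++ false ∷ xs ≡ word t′ ++ false ∷ xs′ → t ≡ t′ × xs ≡ xs′
word-++-injective nil        nil          refl = refl , refl
word-++-injective (node u v) (node u′ v′) {xs} {xs′} eq
  with word-++-injective u u′ (trans (sym (++-assoc (word u) (false ∷ word v) (false ∷ xs)))
         (trans (∷-injectiveʳ eq) (++-assoc (word u′) (false ∷ word v′) (false ∷ xs′))))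
... | refl , eq′ with word-++-injective v v′ eq′
...   | refl , eq″ = refl , eq″

-- The final height of the lattice path that starts at height `h`, or `nothing` if the path falls
-- below 0.
run : ℕ → List Bool → Maybe ℕ
run h       []           = just h
run h       (true ∷ xs)  = run (suc h) xs
run zero    (false ∷ xs) = nothing
run (suc h) (false ∷ xs) = run h xs

run-word : ∀ h t ys → run h (word t ++ ys) ≡ run h ys
run-word h nil        ys = refl
run-word h (node u v) ys = begin
  run (suc h) ((word u ++ false ∷ word v) ++ ys)
    ≡⟨ cong (run (suc h)) (++-assoc (word u) (false ∷ word v) ys) ⟩
  run (suc h) (word u ++ false ∷ word v ++ ys)    ≡⟨ run-word (suc h) u (false ∷ word v ++ ys) ⟩
  run h (word v ++ ys)                            ≡⟨ run-word h v ys ⟩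
  run h ys                                        ∎
  where open ≡-Reasoning

run-word₀ : ∀ t {xs} → word t ≡ xs → run 0 xs ≡ just 0
run-word₀ t refl = trans (cong (run 0) (sym (++-identityʳ (word t)))) (run-word 0 t [])

run-++ : ∀ h xs {ys k} → run h (xs ++ ys) ≡ just k → ∃ λ j → run h xs ≡ just j × run j ys ≡ just k
run-++ h       []           eq = h , refl , eq
run-++ h       (true ∷ xs)  eq = run-++ (suc h) xs eq
run-++ (suc h) (false ∷ xs) eq = run-++ h xs eq

run-+ : ∀ h xs c {j} → run h xs ≡ just j → run (h + c) xs ≡ just (j + c)
run-+ h       []           c refl = refl
run-+ h       (true ∷ xs)  c eq   = run-+ (suc h) xs c eq
run-+ (suc h) (false ∷ xs) c eq   = run-+ h xs c eq

-- The prefix `ys` ends at some height i, and `zs` has to lead from i down to 0; a rise from 0 would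
-- lift it to `suc j + i` instead.
run-ascent : ∀ t ys zs j → word t ≡ ys ++ zs → run 0 zs ≢ just (suc j)
run-ascent t ys zs j eq up with i , _ , down ← run-++ 0 ys (run-word₀ t eq)
  with () ← trans (sym down) (run-+ 0 zs i up)

run-ascent-true : ∀ t ys zs j → word t ≡ ys ++ true ∷ zs → run 0 zs ≢ just j
run-ascent-true t ys zs j eq up = run-ascent t ys (true ∷ zs) j eq
  (trans (run-+ 0 zs 1 up) (cong just (+-comm j 1)))

split : ∀ {A : Set} k (xs : List A) → k ≤ length xs → ∃₂ λ ys zs → xs ≡ ys ++ zs × length ys ≡ k
split k xs k≤ = take k xs , drop k xs , sym (take++drop≡id k xs) , trans (length-take k xs) (m≤n⇒m⊓n≡m k≤)

-- Write `word t′` as ys zs with ys of length `k`; the shift is zs 0 ys. If ys is not empty, zs 0 is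
-- a prefix of `word t`, so zs rises to a positive height, which `run-ascent` forbids for a suffix
-- of `word t′`.
word-false-rotl : ∀ t t′ k → k ≤ length (word t′) →
  word t ++ [ false ] ≡ rotl ^[ k ] (word t′ ++ [ false ]) → k ≡ 0
word-false-rotl t t′ k k≤ eq with ys , zs , eq₁ , refl ← split k (word t′) k≤ with initLast ys
... | []       = refl
... | ys ∷ʳ′ y = contradiction (proj₂ ascent) (run-ascent t′ (ys ∷ʳ y) zs (proj₁ ascent) eq₁)
  where
  rotated : rotl ^[ length (ys ∷ʳ y) ] (word t′ ++ [ false ]) ≡ ((zs ++ [ false ]) ++ ys) ∷ʳ y
  rotated = begin
    rotl ^[ length (ys ∷ʳ y) ] (word t′ ++ [ false ])
      ≡⟨ cong (rotl ^[ length (ys ∷ʳ y) ]_) (trans (cong (_++ [ false ]) eq₁) (++-assoc (ys ∷ʳ y) zs [ false ])) ⟩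
    rotl ^[ length (ys ∷ʳ y) ] ((ys ∷ʳ y) ++ zs ++ [ false ])
      ≡⟨ rotl-++ (ys ∷ʳ y) (zs ++ [ false ]) ⟩
    (zs ++ [ false ]) ++ ys ∷ʳ y
      ≡⟨ ++-assoc (zs ++ [ false ]) ys [ y ] ⟨
    ((zs ++ [ false ]) ++ ys) ∷ʳ y ∎
    where open ≡-Reasoning
  ascent : ∃ λ j → run 0 zs ≡ just (suc j)
  ascent with _ , e , _ ← run-++ 0 (zs ++ [ false ])
                (run-word₀ t (∷ʳ-injectiveˡ (word t) ((zs ++ [ false ]) ++ ys) (trans eq rotated)))
    with run-++ 0 zs e
  ... | suc j , e′ , _ = j , e′

-- For a positive shift, `word t′` is ys zs with zs non-empty, and the shifted word is zs 1 ys. Then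
-- zs is 1 zs′ with zs′ a prefix of `word t`, which never falls below 0, and the suffix 1 zs′ of
-- `word t′` would rise.
true-word-rotl : ∀ t t′ k → k ≤ length (word t′) →
  true ∷ word t ≡ rotl ^[ k ] (true ∷ word t′) → k ≡ 0
true-word-rotl t t′ zero    k≤ eq = refl
true-word-rotl t t′ (suc k) k≤ eq with ys , zs , eq₁ , refl ← split k (word t′) (<⇒≤ k≤) =
  contradiction (trans eq (trans (cong (λ w → rotl ^[ suc k ] (true ∷ w)) eq₁) (rotl-++ (true ∷ ys) zs)))
    (not-canonical ys zs k≤ eq₁)
  where
  not-canonical : ∀ ys zs → length ys < length (word t′) → word t′ ≡ ys ++ zs → true ∷ word t ≢ zs ++ true ∷ ys
  not-canonical ys []          ys< eq₁ _  = <⇒≢ ys< (sym (cong length (trans eq₁ (++-identityʳ ys))))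
  not-canonical ys (false ∷ _) _   _   ()
  not-canonical ys (true ∷ zs) _   eq₁ eq₂ with j , e , _ ← run-++ 0 zs (run-word₀ t (∷-injectiveʳ eq₂)) =
    run-ascent-true t′ ys zs j eq₁ e

rotl-injective : ∀ {A : Set} {xs ys : List A} → rotl xs ≡ rotl ys → xs ≡ ys
rotl-injective {xs = []}          {[]}          _  = refl
rotl-injective {xs = []}          {_ ∷ []}      ()
rotl-injective {xs = []}          {_ ∷ _ ∷ _}   ()
rotl-injective {xs = _ ∷ []}      {[]}          ()
rotl-injective {xs = _ ∷ _ ∷ _}   {[]}          ()
rotl-injective {xs = x ∷ xs}      {y ∷ ys}      eq with refl , refl ← ∷ʳ-injective xs ys eq = refl

-- `C` stands for either canonical form. Cancelling the smaller of two shifts leaves one canonical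
-- word as a shift of another, where `C-rotl` applies.
module _ (C : Tree → List Bool) (C-injective : ∀ {t t′} → C t ≡ C t′ → t ≡ t′)
         (C-rotl : ∀ t t′ k → k ≤ length (word t′) → C t ≡ rotl ^[ k ] (C t′) → k ≡ 0) where

  rotl-C-injective≤ : ∀ t t′ {j k} → j ≤ k → k ≤ length (word t′) →
    rotl ^[ j ] (C t) ≡ rotl ^[ k ] (C t′) → t ≡ t′ × j ≡ k
  rotl-C-injective≤ t t′ {j} j≤k k≤ eq with d , refl ← m≤n⇒∃[o]m+o≡n j≤k
    with eq′ ← ^-injective rotl-injective j (trans eq (^-+ rotl j d (C t′)))
    with refl ← C-rotl t t′ d (≤-trans (m≤n+m d j) k≤) eq′ =
    C-injective eq′ , sym (+-identityʳ j)

  rotl-C-injective : ∀ t t′ {j k} → j ≤ length (word t) → k ≤ length (word t′) →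
    rotl ^[ j ] (C t) ≡ rotl ^[ k ] (C t′) → t ≡ t′ × j ≡ k
  rotl-C-injective t t′ {j} {k} j≤ k≤ eq with ≤-total j k
  ... | inj₁ j≤k = rotl-C-injective≤ t t′ j≤k k≤ eq
  ... | inj₂ k≤j with refl , refl ← rotl-C-injective≤ t′ t k≤j j≤ (sym eq) = refl , refl

module _ {n : ℕ} where

  private
    shift≤ : ∀ t → .(size t ≡ n) → (s : Fin (suc (2 * n))) → toℕ s ≤ length (word t)
    shift≤ t p s rewrite length-word t | sized t p = s≤s⁻¹ (Fin.toℕ<n s)

  trues-emb : (v : Vertex n) → trues (emb v) ≡ (if side v then n else suc n)
  trues-emb (A t p s) = trans (trues-rotl (toℕ s) (word t ++ [ false ]))
    (trans (trues-++ (word t) [ false ]) (trans (+-identityʳ _) (trans (trues-word t) (sized t p))))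
  trues-emb (B t p s) = trans (trues-rotl (toℕ s) (true ∷ word (rotate t)))
    (cong suc (trans (trues-word (rotate t)) (trans (size-rotate t) (sized t p))))

  emb-injective : ∀ {v w : Vertex n} → emb v ≡ emb w → v ≡ w
  emb-injective {A t p s} {A t′ p′ s′} eq
    with rotl-C-injective (λ t → word t ++ [ false ]) (λ {a} {b} e → proj₁ (word-++-injective a b e)) word-false-rotl
           t t′ (shift≤ t p s) (shift≤ t′ p′ s′) eq
  ... | refl , e with refl ← Fin.toℕ-injective e = refl
  emb-injective {B t p s} {B t′ p′ s′} eq
    with rotl-C-injective (λ t → true ∷ word t)
           (λ {a} {b} e → proj₁ (word-++-injective a b (cong (_++ [ false ]) (∷-injectiveʳ e)))) true-word-rotl
           (rotate t) (rotate t′) (shift≤ (rotate t) (trans (size-rotate t) p) s)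
           (shift≤ (rotate t′) (trans (size-rotate t′) p′) s′) eq
  ... | e , e′ with refl ← rotate-injective t t′ e | refl ← Fin.toℕ-injective e′ = refl
  emb-injective {v@(A t p s)} {w@(B t′ p′ s′)} eq =
    contradiction (trans (sym (trues-emb v)) (trans (cong trues eq) (trues-emb w))) (1+n≢n ∘ sym)
  emb-injective {v@(B t p s)} {w@(A t′ p′ s′)} eq =
    contradiction (trans (sym (trues-emb v)) (trans (cong trues eq) (trues-emb w))) 1+n≢n

~-size : ∀ {t t′} → t ~ t′ → size t ≡ size t′
~-size = gfold isEquivalence size λ { {t} refl → sym (size-rotate t) }

-- Passage to bitstrings.

-- Truncates or pads lists whose length is not m; only used for length m.
toBitstring : ∀ m → List Bool → Bitstring m
toBitstring zero    _        = []
toBitstring (suc m) []       = false ∷ toBitstring m []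
toBitstring (suc m) (x ∷ xs) = x ∷ toBitstring m xs

toBitstring-toList : ∀ {m} (x : Bitstring m) → toBitstring m (toList x) ≡ x
toBitstring-toList []      = refl
toBitstring-toList (b ∷ x) = cong (b ∷_) (toBitstring-toList x)

toList-toBitstring : ∀ {m} xs → length xs ≡ m → toList (toBitstring m xs) ≡ xs
toList-toBitstring []       refl = refl
toList-toBitstring (x ∷ xs) refl = cong (x ∷_) (toList-toBitstring xs refl)

weight-toList : ∀ {m} (x : Bitstring m) → weight x ≡ trues (toList x)
weight-toList []          = refl
weight-toList (true ∷ x)  = cong suc (weight-toList x)
weight-toList (false ∷ x) = weight-toList x

hamming-refl : ∀ {m} (x : Bitstring m) → hamming x x ≡ 0
hamming-refl []          = refl
hamming-refl (true ∷ x)  = hamming-refl x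
hamming-refl (false ∷ x) = hamming-refl x

flip⇒adjacent : ∀ {m xs ys} → Flip xs ys → length xs ≡ m → Adjacent (toBitstring m xs) (toBitstring m ys)
flip⇒adjacent (here {true}  {true}  x≢y) _ = contradiction refl x≢y
flip⇒adjacent (here {false} {false} x≢y) _ = contradiction refl x≢y
flip⇒adjacent (here {true}  {false} {xs} x≢y) refl = cong suc (hamming-refl (toBitstring (length xs) xs))
flip⇒adjacent (here {false} {true}  {xs} x≢y) refl = cong suc (hamming-refl (toBitstring (length xs) xs))
flip⇒adjacent (there {true}  f) refl = flip⇒adjacent f refl
flip⇒adjacent (there {false} f) refl = flip⇒adjacent f refl

-- Growing a spanning tour from the star.

toℕ-prev-zero : ∀ {m} (i : Fin (suc m)) → toℕ i ≡ 0 → toℕ (prev i) ≡ m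
toℕ-prev-zero {m} zero _ = Fin.toℕ-fromℕ m

toℕ-prev-suc : ∀ {m j} (i : Fin (suc m)) → toℕ i ≡ suc j → toℕ (prev i) ≡ j
toℕ-prev-suc (suc i) refl = Fin.toℕ-inject₁ i

-- 2 generates the integers modulo the odd number 2n + 1: from 0 the property climbs through the
-- even shifts to 2n, passes to 1, and climbs through the odd ones.
prev²-generates : ∀ n (P : Fin (suc (2 * n)) → Set) → P zero → (∀ i → P (prev (prev i)) → P i) → ∀ i → P i
prev²-generates n P P0 P-prev² i = all (toℕ i) i refl
  where
  Q : ℕ → Set
  Q k = ∀ i → toℕ i ≡ k → P i

  Q0 : Q 0
  Q0 zero _ = P0

  step : ∀ k → Q k → Q (2 + k)
  step k q i eq = P-prev² i (q (prev (prev i)) (toℕ-prev-suc (prev i) (toℕ-prev-suc i eq)))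

  even : ∀ k → Q (2 * k)
  even zero    = Q0
  even (suc k) = subst Q (sym (*-suc 2 k)) (step (2 * k) (even k))

  -- The shift wraps around from 1 to the even number 2n.
  all : ∀ k → Q k
  all zero          = Q0
  all (suc zero)    = λ i eq → P-prev² i (even n (prev (prev i)) (toℕ-prev-zero (prev i) (toℕ-prev-suc i eq)))
  all (suc (suc k)) = step k (all k)

module _ {n : ℕ} where

  open DecMembership (_≟ᵛ_ {n}) using (_∈?_)

  glueable-unique : ∀ {x x′ y : Vertex n} → Glueable x y → Glueable x′ y → x ≡ x′
  glueable-unique (glueable u v p q s) (glueable _ _ _ _ _) = refl

  glueable-sideˡ : ∀ {x y : Vertex n} → Glueable x y → side x ≡ true
  glueable-sideˡ (glueable _ _ _ _ _) = refl

  glueable-sideʳ : ∀ {x y : Vertex n} → Glueable x y → side y ≡ true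
  glueable-sideʳ (glueable _ _ _ _ _) = refl

  glueable-≢ : ∀ {x y x′ y′ : Vertex n} → Glueable x y → Glueable x′ y′ → y ≢ x′
  glueable-≢ (glueable _ _ _ _ _) (glueable _ _ _ _ _) ()

  open Gluing {Vertex n} _≟ᵛ_ F F-injective periodic Adj flip-sym adj-F side side-F Glueable
    glueable-unique glueable-sideˡ glueable-sideʳ glueable-≢
    glueable-period glueable-adj₁ glueable-adj₂ glueable-adj₃
  open Tour

  -- All shifts are demanded at once, which makes the notion invariant under `rotate` although `F`
  -- changes the shift as well.
  Contains : Tour → Tree → Set
  Contains T t = ∀ .(p : size t ≡ n) s → A t p s ∈ vertices T

  infix 4 _⊑_
  record _⊑_ (T T′ : Tour) : Set where
    constructor incl
    field member : ∀ {v} → v ∈ vertices T → v ∈ vertices T′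
  open _⊑_

  ⊑-refl : ∀ {T} → T ⊑ T
  ⊑-refl = incl id

  ⊑-trans : ∀ {T T′ T″} → T ⊑ T′ → T′ ⊑ T″ → T ⊑ T″
  ⊑-trans p q = incl (member q ∘ member p)

  contains-rotate⁺ : ∀ T t → Contains T t → Contains T (rotate t)
  contains-rotate⁺ T t c p s with prev-surjective s
  ... | s′ , refl = F⁺ T (F⁺ T (c (trans (sym (size-rotate t)) p) s′))

  contains-rotate⁻ : ∀ T t → Contains T (rotate t) → Contains T t
  contains-rotate⁻ T t c p s = F⁻ T {A t p s} (F⁻ T {B t p s} (c (trans (size-rotate t) p) (prev s)))

  contains-~ : ∀ T {t t′} → t ~ t′ → Contains T t → Contains T t′
  contains-~ T ε              c = c
  contains-~ T {t} (fwd refl ◅ e) c = contains-~ T {rotate t} e (contains-rotate⁺ T t c)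
  contains-~ T (_◅_ {j = t} (bwd refl) e) c = contains-~ T {t} e (contains-rotate⁻ T t c)

  -- As `P` survives enlargement of the tour, the extensions can be made one after another.
  extend-all : ∀ {X : Set} (P : X → Tour → Set) → (∀ {x T T′} → T ⊑ T′ → P x T → P x T′) →
    ∀ T₀ → (∀ x T → T₀ ⊑ T → ∃ λ T′ → T ⊑ T′ × P x T′) →
    ∀ xs → ∃ λ T′ → T₀ ⊑ T′ × (∀ {x} → x ∈ xs → P x T′)
  extend-all P mono T₀ step []       = T₀ , ⊑-refl , λ ()
  extend-all P mono T₀ step (x ∷ xs) with extend-all P mono T₀ step xs
  ... | T , T₀⊑T , all with step x T T₀⊑T
  ...   | T′ , T⊑T′ , Px = T′ , ⊑-trans T₀⊑T T⊑T′ , λ where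
            (here refl) → Px
            (there x∈)  → mono T⊑T′ (all x∈)

  -- There is one gluing for each shift, except for shifts that already came in with an earlier
  -- orbit.
  extend-glue : ∀ u v → size (node nil (node u v)) ≡ n → ∀ T → Contains T (node nil (node u v)) →
                ∃ λ T′ → T ⊑ T′ × Contains T′ (node (node nil u) v)
  extend-glue u v p T c
    with extend-all (λ s T → A (node (node nil u) v) p s ∈ vertices T) (λ T⊑T′ → member T⊑T′) T step (allFin _)
    where
    step : ∀ s T₁ → T ⊑ T₁ → ∃ λ T₂ → T₁ ⊑ T₂ × A (node (node nil u) v) p s ∈ vertices T₂
    step s T₁ T⊑T₁ with A (node (node nil u) v) p s ∈? vertices T₁
    ... | yes x∈ = T₁ , ⊑-refl , x∈
    ... | no  x∉ = case Glue.glue T₁ (glueable u v p p s) x∉ (member T⊑T₁ (c p s)) of λ where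
          (T₂ , T₁⊆T₂ , x∈) → T₂ , incl T₁⊆T₂ , x∈
  ... | T′ , T⊑T′ , all = T′ , T⊑T′ , λ _ s → all (∈-allFin s)

  -- Two rotations fix the star, so `F ^[ 4 ]` changes only the shift, by 2, and `prev²-generates`
  -- reaches all shifts.
  contains-star : ∀ T → 1 ≤ n → A (star n) (size-star n) zero ∈ vertices T → Contains T (star n)
  contains-star T n≥1 zero∈ _ = prev²-generates n _ zero∈ prev²
    where
    rotate² : ∀ {m} → 1 ≤ m → rotate (rotate (star m)) ≡ star m
    rotate² {suc m} _ = star-▹ m

    A-cong : ∀ {t t′} (e : t ≡ t′) .{p : size t ≡ n} .{p′ : size t′ ≡ n} {s} → A t p s ≡ A t′ p′ s
    A-cong refl = refl

    prev² : ∀ s → A (star n) (size-star n) (prev (prev s)) ∈ vertices T → A (star n) (size-star n) s ∈ vertices T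
    prev² s x∈ = F⁻ T {A t p s} (F⁻ T {B t p s} (F⁻ T {A t′ p′ s′} (F⁻ T {B t′ p′ s′}
      (subst (_∈ vertices T) (A-cong (sym (rotate² n≥1))) x∈))))
      where
      t  = star n
      p  = size-star n
      t′ = rotate t
      p′ = trans (size-rotate t) p
      s′ = prev s

  module _ (T₀ : Tour) (T₀-star : Contains T₀ (star n)) where

    -- Induction on `depthSum`, bounded by `k`: the pulled tree `t′` is brought in first, and its
    -- class then offers the place at which the class of `t` is glued in.
    extend : ∀ k t → depthSum t < k → size t ≡ n → ∀ T → T₀ ⊑ T → ∃ λ T′ → T ⊑ T′ × Contains T′ t
    extend (suc k) t d p T T₀⊑T with star⊎pull t
    ... | inj₁ eq = T , ⊑-refl , 
      λ q → subst (λ t → Contains T t) (sym (trans eq (cong star p))) (λ r s → member T₀⊑T (T₀-star r s)) q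
    ... | inj₂ (t′ , pl) with pull-gluingPair pl
    ...   | u , v , t~x , y~t′ 
        with extend k t′ (<-≤-trans (pull-depthSum pl) (s≤s⁻¹ d)) (trans (pull-size pl) p) T T₀⊑T
    ...     | T₁ , T⊑T₁ , c 
        with extend-glue u v (trans (~-size y~t′) (trans (pull-size pl) p)) T₁ (contains-~ T₁ (symmetric _ y~t′) c)
    ...       | T₂ , T₁⊑T₂ , c′ = T₂ , ⊑-trans T⊑T₁ T₁⊑T₂ , contains-~ T₂ (symmetric _ t~x) c′

    spanningTour : ∃ λ T → ∀ v → v ∈ vertices T
    spanningTour with extend-all (λ t T → Contains T t) (λ T⊑T′ c p s → member T⊑T′ (c p s)) T₀ step (trees n)
      where
      step : ∀ t T → T₀ ⊑ T → ∃ λ T′ → T ⊑ T′ × Contains T′ t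
      step t T T₀⊑T with size t ≟ n
      ... | yes p = extend (suc (depthSum t)) t (n<1+n _) p T T₀⊑T
      -- The list `trees n` also has trees of other sizes, for which `Contains` is vacuous.
      ... | no ¬p = T , ⊑-refl , λ p → contradiction (sized t p) ¬p
    ... | T , _ , all = T , λ where
      (A t p s) → all (∈-trees n t (≤-reflexive (sized t p))) p s
      (B t p s) → F⁺ T (all (∈-trees n t (≤-reflexive (sized t p))) p s)

  starTour : Tour
  starTour = orbitTour (A (star n) (size-star n) zero) refl

  hamiltonCycle : (T : Tour) → (∀ v → v ∈ vertices T) → HamiltonCycle n
  hamiltonCycle T all = record
    { start    = toVec (start T)
    ; rest     = map toVec (rest T)
    ; vertices = All.map⁺ {xs = vertices T} (All.universal toVec-middle (vertices T))
    ; distinct = Unique.map⁺ toVec-injective (unique T)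
    ; spanning = λ x mid → 
        case emb-surjective {n} (toList x) (length-toList x)
               (subst (λ k → k ≡ n ⊎ k ≡ suc n) (weight-toList x) mid) of λ where
          (v , eq) → subst (_∈ map toVec (vertices T)) 
            (trans (cong (toBitstring _) eq) (toBitstring-toList x)) (∈-map⁺ toVec (all v))
    ; edges    = path-map (path T)
    ; closing  = subst (λ x → Adjacent x (toVec (start T))) (sym (lastOf-map (start T) (rest T)))
        (toVec-adj {lastOf (start T) (rest T)} {start T} (closing T))
    }
    where
    toVec : Vertex n → Bitstring (suc (2 * n))
    toVec v = toBitstring (suc (2 * n)) (emb v)

    toList-toVec : ∀ v → toList (toVec v) ≡ emb v
    toList-toVec v = toList-toBitstring (emb v) (length-emb v)

    toVec-middle : ∀ v → MiddleVertex n (toVec v)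
    toVec-middle v = subst (λ k → k ≡ n ⊎ k ≡ suc n)
      (sym (trans (weight-toList (toVec v)) (trans (cong trues (toList-toVec v)) (trues-emb v)))) (middle v)
      where
      middle : ∀ v → (if side v then n else suc n) ≡ n ⊎ (if side v then n else suc n) ≡ suc n
      middle (A _ _ _) = inj₁ refl
      middle (B _ _ _) = inj₂ refl

    toVec-injective : ∀ {v w} → toVec v ≡ toVec w → v ≡ w
    toVec-injective {v} {w} eq = emb-injective
      (trans (sym (toList-toVec v)) (trans (cong toList eq) (toList-toVec w)))

    toVec-adj : ∀ {v w} → Adj v w → Adjacent (toVec v) (toVec w)
    toVec-adj {v} f = flip⇒adjacent f (length-emb v)

    path-map : ∀ {vs} → Path Adj vs → Path Adjacent (map toVec vs)
    path-map path[]      = path[]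
    path-map path[ v ]   = path[ toVec v ]
    path-map (path∷ {v} {w} r p) = path∷ (toVec-adj {v} {w} r) (path-map p)

    lastOf-map : ∀ v vs → lastOf (toVec v) (map toVec vs) ≡ toVec (lastOf v vs)
    lastOf-map v []       = refl
    lastOf-map v (w ∷ vs) = lastOf-map w vs

theorem1 : (n : ℕ) → n ≥ 1 → HamiltonCycle n
theorem1 n n≥1 = hamiltonCycle (proj₁ spanning) (proj₂ spanning)
  where
  T₀ = starTour {n}
  spanning = spanningTour T₀ (contains-star T₀ n≥1 (here refl))
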